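{- Let $V$ be a real normed space of finite dimension $d\ge 1$, let $U$ be an abelian group with a translation-invariant ultrametric, let $\Lambda\subset V\times U$ be a closed additive subgroup, and let $X=(V\times U)/\Lambda$ carry the quotient metric induced by the maximum product metric. Let $\alpha\in X$ have strict best-return denominators $q_1<q_2<\cdots$, and let $\overline V$ be the reduced real factor. Then $$q_{n+P(\overline V)+1}>q_n+q_{n+1}$$ for every $n\ge1$ for which the left-hand side is defined. If $V$ is an inner-product space, then, with $E_\Lambda$ the effective real factor, the stronger bound $$q_{n+P(E_\Lambda)+1}>q_n+q_{n+1}$$ holds for every $n\ge1$ for which the left-hand side is defined.
   Context: Metric setting. Write the ultrametric on $U$ as $d_U(u,w)=|u-w|_U$, so $|u+w|_U\le\max\{|u|_U,|w|_U\}$. On $V\times U$ put $|(v,u)|=\max\{\|v\|_V,|u|_U\}$; "closed" refers to the induced metric topology. On $X=(V\times U)/\Lambda$ put $\|a+\Lambda\|_X=\inf_{\lambda\in\Lambda}|a-\lambda|$ and $d_X(x,y)=\|x-y\|_X$. The infimum need not be attained. Best returns. For positive integers $q$ put $\rho(q)=d_X(q\alpha,0)$. The strict best-return denominators of $\alpha$ are $q_1=1$ and $q_{n+1}=\min\{q>q_n:\rho(q)<\rho(q_n)\}$ as long as such $q$ exists; the sequence may terminate, and a zero return (if any) is retained as its final term. Packing number. For a finite-dimensional real normed space $Y$, $P(Y)$ is the maximal cardinality of a set $S\subset\{v\in Y:\|v\|_Y<1\}$ (open unit ball) with $\|v-w\|_Y\ge1$ for all distinct $v,w\in S$. This maximum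 is finite, and $P(\{0\})=1$. Reduced real factor. $W=\{v\in V:(tv,0)\in\Lambda\text{ for every }t\in\mathbb R\}$, a linear subspace of $V$; $\overline V=V/W$ with the quotient norm. Effective real factor (when $V$ is an inner-product space). Let $\pi:V\to W^\perp$ be orthogonal projection. Then $E_\Lambda=\operatorname{span}_{\mathbb R}\{\pi(v):(v,u)\in\Lambda\}\subset W^\perp$, with the induced inner product and norm. -}

module Defs where

open import Algebra.Bundles using (AbelianGroup; CommutativeRing)
open import Algebra.Module.Bundles using (LeftModule)
open import Axiom.ExcludedMiddle using (ExcludedMiddle)
open import Data.Fin.Base using (Fin)
open import Data.Nat.Base as ℕ using (ℕ)
open import Data.Product using (Σ; ∃; _×_; _,_; proj₁; proj₂)
open import Data.Sum.Base using (inj₁; inj₂)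
open import Function.Metric.Definitions using (TranslationInvariant)
open import Function.Metric.Structures using (IsGeneralMetric)
open import Level using (Level; suc)
open import Relation.Binary.Bundles using (TotalOrder)
open import Relation.Binary.Core using (Rel)
open import Relation.Binary.PropositionalEquality.Core using (_≢_)
open import Relation.Binary.Structures using (IsTotalOrder)
open import Relation.Nullary using (yes; no)
open import Relation.Nullary.Negation using (contradiction)
open import Relation.Unary using (Pred)
import Algebra.Construct.DirectProduct as DirectProduct
import Algebra.Construct.NaturalChoice.Max as NaturalMax
import Algebra.Definitions.RawMonoid as RawMonoidDefs
import Algebra.Properties.AbelianGroup as AbelianGroupProperties
import Algebra.Properties.CommutativeSemigroup as CommutativeSemigroupProperties
import Algebra.Properties.Ring as RingProperties
import Relation.Binary.Construct.NonStrictToStrict as NonStrictToStrict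
import Relation.Binary.Reasoning.PartialOrder as PosetReasoning
import Relation.Binary.Reasoning.Setoid as SetoidReasoning

private
  variable
    ℓ : Level

-- The library has no real numbers.  They are taken here in their classical
-- axiomatic form, as an arbitrary Dedekind-complete totally ordered field;
-- classically any two of these are isomorphic.

record Reals ℓ : Set (suc ℓ) where
  infix 4 _≤_
  field
    commutativeRing : CommutativeRing ℓ ℓ

  open CommutativeRing commutativeRing public renaming (Carrier to ℝ)

  field
    _≤_          : Rel ℝ ℓ
    isTotalOrder : IsTotalOrder _≈_ _≤_
    0≉1          : 0# ≉ 1#
    inverse      : ∀ x → x ≉ 0# → ∃ λ y → x * y ≈ 1#
    +-monoʳ-≤    : ∀ x {y z} → y ≤ z → x + y ≤ x + z
    *-nonneg     : ∀ {x y} → 0# ≤ x → 0# ≤ y → 0# ≤ x * y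
    complete     : (S : Pred ℝ ℓ) → ∃ S → (∃ λ b → ∀ x → S x → x ≤ b) →
                   ∃ λ s → (∀ x → S x → x ≤ s) ×
                           (∀ b → (∀ x → S x → x ≤ b) → s ≤ b)

  LowerBound UpperBound : Pred ℝ ℓ → Pred ℝ ℓ
  LowerBound S b = ∀ x → S x → b ≤ x
  UpperBound S b = ∀ x → S x → x ≤ b

  totalOrder : TotalOrder ℓ ℓ ℓ
  totalOrder = record { isTotalOrder = isTotalOrder }

  open TotalOrder totalOrder public
    using (poset; total; antisym)
    renaming (refl to ≤-refl; reflexive to ≤-reflexive; trans to ≤-trans
             ; ≤-respˡ-≈ to ≤-respˡ; ≤-respʳ-≈ to ≤-respʳ)
  open NonStrictToStrict _≈_ _≤_ public using (_<_)
  open NaturalMax totalOrder public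
    using (_⊔_; x≤x⊔y; x≤y⊔x; ⊔-cong; x≤y⇒x⊔y≈y; x≤y⇒y⊔x≈y)

  ∣_∣ : ℝ → ℝ
  ∣ x ∣ = x ⊔ (- x)

  -- The infimum, as the supremum of the lower bounds.
  module _ (S : Pred ℝ ℓ) (inhabited : ∃ S) (bounded : ∃ (LowerBound S)) where
    private
      sup-lower : ∃ λ s → UpperBound (LowerBound S) s ×
                          LowerBound (UpperBound (LowerBound S)) s
      sup-lower = complete (LowerBound S) bounded
        (proj₁ inhabited , λ b lb → lb _ (proj₂ inhabited))

    inf : ℝ
    inf = proj₁ sup-lower

    inf-lower : LowerBound S inf
    inf-lower x Sx = proj₂ (proj₂ sup-lower) x λ b lb → lb x Sx

    inf-greatest : UpperBound (LowerBound S) inf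
    inf-greatest = proj₁ (proj₂ sup-lower)

module RealProperties (R : Reals ℓ) where
  open Reals R
  open RingProperties ring

  +-mono-≤ : ∀ {a b c d} → a ≤ b → c ≤ d → a + c ≤ b + d
  +-mono-≤ {a} {b} {c} {d} p q = begin
    a + c ≤⟨ +-monoʳ-≤ a q ⟩
    a + d ≈⟨ +-comm a d ⟩
    d + a ≤⟨ +-monoʳ-≤ d p ⟩
    d + b ≈⟨ +-comm d b ⟩
    b + d ∎
    where open PosetReasoning poset

  [x-y]+y≈x : ∀ x y → (x - y) + y ≈ x
  [x-y]+y≈x x y = begin
    (x - y) + y   ≈⟨ +-assoc x (- y) y ⟩
    x + (- y + y) ≈⟨ +-congˡ (-‿inverseˡ y) ⟩
    x + 0#        ≈⟨ +-identityʳ x ⟩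
    x             ∎
    where open SetoidReasoning setoid

  x≤y+z⇒x-z≤y : ∀ {x y z} → x ≤ y + z → x - z ≤ y
  x≤y+z⇒x-z≤y {x} {y} {z} p = begin
    x - z       ≤⟨ +-mono-≤ p ≤-refl ⟩
    (y + z) - z ≈⟨ +-assoc y z (- z) ⟩
    y + (z - z) ≈⟨ +-congˡ (-‿inverseʳ z) ⟩
    y + 0#      ≈⟨ +-identityʳ y ⟩
    y           ∎
    where open PosetReasoning poset

  x-z≤y⇒x≤y+z : ∀ {x y z} → x - z ≤ y → x ≤ y + z
  x-z≤y⇒x≤y+z {x} {y} {z} p = begin
    x           ≈⟨ [x-y]+y≈x x z ⟨
    (x - z) + z ≤⟨ +-mono-≤ p ≤-refl ⟩
    y + z       ∎
    where open PosetReasoning poset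

  0≤y-x : ∀ {x y} → x ≤ y → 0# ≤ y - x
  0≤y-x {x} {y} p = begin
    0#    ≈⟨ -‿inverseʳ x ⟨
    x - x ≤⟨ +-mono-≤ p ≤-refl ⟩
    y - x ∎
    where open PosetReasoning poset

  *-monoˡ-≤ : ∀ {a b c} → 0# ≤ a → b ≤ c → a * b ≤ a * c
  *-monoˡ-≤ {a} {b} {c} 0≤a b≤c = begin
    a * b                  ≈⟨ +-identityˡ _ ⟨
    0# + a * b             ≤⟨ +-mono-≤ (*-nonneg 0≤a (0≤y-x b≤c)) ≤-refl ⟩
    a * (c - b) + a * b    ≈⟨ distribˡ a (c - b) b ⟨
    a * ((c - b) + b)      ≈⟨ *-congˡ ([x-y]+y≈x c b) ⟩
    a * c                  ∎
    where open PosetReasoning poset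

  x≤0⇒0≤-x : ∀ {x} → x ≤ 0# → 0# ≤ - x
  x≤0⇒0≤-x {x} p = ≤-respʳ (+-identityˡ (- x)) (0≤y-x p)

  0≤x⇒-x≤0 : ∀ {x} → 0# ≤ x → - x ≤ 0#
  0≤x⇒-x≤0 {x} p = ≤-respˡ (+-identityˡ (- x))
    (x≤y+z⇒x-z≤y (≤-respʳ (sym (+-identityˡ x)) p))

  0≤x⇒∣x∣≈x : ∀ {x} → 0# ≤ x → ∣ x ∣ ≈ x
  0≤x⇒∣x∣≈x p = x≤y⇒y⊔x≈y (≤-trans (0≤x⇒-x≤0 p) p)

  x≤0⇒∣x∣≈-x : ∀ {x} → x ≤ 0# → ∣ x ∣ ≈ - x
  x≤0⇒∣x∣≈-x p = x≤y⇒x⊔y≈y (≤-trans p (x≤0⇒0≤-x p))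

  ∣∣-cong : ∀ {x y} → x ≈ y → ∣ x ∣ ≈ ∣ y ∣
  ∣∣-cong x≈y = ⊔-cong x≈y (-‿cong x≈y)

  0≤∣x∣ : ∀ x → 0# ≤ ∣ x ∣
  0≤∣x∣ x with total 0# x
  ... | inj₁ p = ≤-trans p (x≤x⊔y x (- x))
  ... | inj₂ p = ≤-trans (x≤0⇒0≤-x p) (x≤y⊔x x (- x))

  -x*-y≈x*y : ∀ x y → - x * - y ≈ x * y
  -x*-y≈x*y x y = begin
    - x * - y     ≈⟨ -‿distribˡ-* x (- y) ⟨
    - (x * - y)   ≈⟨ -‿cong (sym (-‿distribʳ-* x y)) ⟩
    - (- (x * y)) ≈⟨ -‿involutive (x * y) ⟩
    x * y         ∎
    where open SetoidReasoning setoid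

  ∣x∣*∣y∣≈∣x*y∣ : ∀ x y → ∣ x ∣ * ∣ y ∣ ≈ ∣ x * y ∣
  ∣x∣*∣y∣≈∣x*y∣ x y with total 0# x | total 0# y
  ... | inj₁ p | inj₁ q =
    trans (*-cong (0≤x⇒∣x∣≈x p) (0≤x⇒∣x∣≈x q)) (sym (0≤x⇒∣x∣≈x (*-nonneg p q)))
  ... | inj₂ p | inj₂ q =
    trans (*-cong (x≤0⇒∣x∣≈-x p) (x≤0⇒∣x∣≈-x q)) (trans (-x*-y≈x*y x y)
      (sym (0≤x⇒∣x∣≈x (≤-respʳ (-x*-y≈x*y x y)
        (*-nonneg (x≤0⇒0≤-x p) (x≤0⇒0≤-x q))))))
  ... | inj₁ p | inj₂ q =
    trans (*-cong (0≤x⇒∣x∣≈x p) (x≤0⇒∣x∣≈-x q)) (trans (sym (-‿distribʳ-* x y))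
      (sym (x≤0⇒∣x∣≈-x (≤-respˡ (trans (-‿cong (sym (-‿distribʳ-* x y)))
        (-‿involutive (x * y))) (0≤x⇒-x≤0 (*-nonneg p (x≤0⇒0≤-x q)))))))
  ... | inj₂ p | inj₁ q =
    trans (*-cong (x≤0⇒∣x∣≈-x p) (0≤x⇒∣x∣≈x q)) (trans (sym (-‿distribˡ-* x y))
      (sym (x≤0⇒∣x∣≈-x (≤-respˡ (trans (-‿cong (sym (-‿distribˡ-* x y)))
        (-‿involutive (x * y))) (0≤x⇒-x≤0 (*-nonneg (x≤0⇒0≤-x p) q))))))

  0≤1 : 0# ≤ 1#
  0≤1 with total 0# 1#
  ... | inj₁ p = p
  ... | inj₂ p = ≤-respʳ (trans (-x*-y≈x*y 1# 1#) (*-identityˡ 1#))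
                   (*-nonneg (x≤0⇒0≤-x p) (x≤0⇒0≤-x p))

module GroupProperties (G : AbelianGroup ℓ ℓ) where
  open AbelianGroup G
  open AbelianGroupProperties G public
  open CommutativeSemigroupProperties commutativeSemigroup using (interchange)
  open SetoidReasoning setoid

  ∙-//-distrib : ∀ a b c d → (a ∙ b) - (c ∙ d) ≈ (a - c) ∙ (b - d)
  ∙-//-distrib a b c d = begin
    (a ∙ b) - (c ∙ d)         ≈⟨ ∙-congˡ (⁻¹-∙-comm c d) ⟨
    (a ∙ b) ∙ (c ⁻¹ ∙ d ⁻¹)    ≈⟨ interchange a b (c ⁻¹) (d ⁻¹) ⟩
    (a - c) ∙ (b - d)        ∎

  //-telescope : ∀ a b c → (a - b) ∙ (b - c) ≈ a - c
  //-telescope a b c = begin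
    (a - b) ∙ (b - c)      ≈⟨ assoc (a - b) b (c ⁻¹) ⟨
    ((a - b) ∙ b) - c      ≈⟨ ∙-congʳ (//-rightDividesˡ b a) ⟩
    a - c                   ∎

  x//ε≈x : ∀ x → x - ε ≈ x
  x//ε≈x x = trans (∙-congˡ ε⁻¹≈ε) (identityʳ x)

record Subgroup (G : AbelianGroup ℓ ℓ) : Set (suc ℓ) where
  open AbelianGroup G
  field
    member    : Pred Carrier ℓ
    resp      : ∀ {x y} → x ≈ y → member x → member y
    ε-closed  : member ε
    ∙-closed  : ∀ {x y} → member x → member y → member (x ∙ y)
    ⁻¹-closed : ∀ {x} → member x → member (x ⁻¹)

-- Quotients keep the carrier and coarsen the equality.
quotientGroup : (G : AbelianGroup ℓ ℓ) → Subgroup G → AbelianGroup ℓ ℓ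
quotientGroup {ℓ} G H = record
  { Carrier = Carrier
  ; _≈_ = _≈/_
  ; _∙_ = _∙_
  ; ε = ε
  ; _⁻¹ = _⁻¹
  ; isAbelianGroup = record
    { isGroup = record
      { isMonoid = record
        { isSemigroup = record
          { isMagma = record
            { isEquivalence = record
              { refl = λ {x} → lift (refl {x})
              ; sym = λ {x} {y} p → resp (⁻¹-anti-homo-// x y) (⁻¹-closed p)
              ; trans = λ {x} {y} {z} p q → resp (//-telescope x y z) (∙-closed p q)
              }
            ; ∙-cong = λ {x} {y} {u} {v} p q →
                resp (sym (∙-//-distrib x u y v)) (∙-closed p q)
            }
          ; assoc = λ x y z → lift (assoc x y z)
          }
        ; identity = (λ x → lift (identityˡ x)) , (λ x → lift (identityʳ x))
        }
      ; inverse = (λ x → lift (inverseˡ x)) , (λ x → lift (inverseʳ x))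
      ; ⁻¹-cong = λ {x} {y} p → resp (sym (⁻¹-∙-comm x (y ⁻¹))) (⁻¹-closed p)
      }
    ; comm = λ x y → lift (comm x y)
    }
  }
  where
  open AbelianGroup G
  open GroupProperties G
  open Subgroup H
  _≈/_ : Rel Carrier ℓ
  x ≈/ y = member (x - y)
  lift : ∀ {x y} → x ≈ y → x ≈/ y
  lift p = resp (sym (x≈y⇒x∙y⁻¹≈ε p)) ε-closed

-- a ↦ inf { N (a - h) ∣ h ∈ H }
module QuotientNorm (R : Reals ℓ) (G : AbelianGroup ℓ ℓ) where
  open Reals R
  private module G = AbelianGroup G

  module _ (N : G.Carrier → ℝ) (N-nonneg : ∀ a → 0# ≤ N a) (H : Subgroup G) where
    open Subgroup H

    Distances : G.Carrier → Pred ℝ ℓ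
    Distances a r = ∃ λ h → member h × r ≈ N (a G.- h)

    Distances-inhabited : ∀ a → ∃ (Distances a)
    Distances-inhabited a = N (a G.- G.ε) , G.ε , ε-closed , refl

    Distances-nonneg : ∀ a → LowerBound (Distances a) 0#
    Distances-nonneg a r (h , _ , r≈) = ≤-respʳ (sym r≈) (N-nonneg _)

    quotientNorm : G.Carrier → ℝ
    quotientNorm a = inf (Distances a) (Distances-inhabited a) (0# , Distances-nonneg a)

    quotientNorm-≤ : ∀ a {h} → member h → quotientNorm a ≤ N (a G.- h)
    quotientNorm-≤ a {h} Hh = inf-lower (Distances a) (Distances-inhabited a)
      (0# , Distances-nonneg a) _ (h , Hh , refl)

    quotientNorm-greatest : ∀ a b → (∀ h → member h → b ≤ N (a G.- h)) →
                            b ≤ quotientNorm a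
    quotientNorm-greatest a b lb = inf-greatest (Distances a) (Distances-inhabited a)
      (0# , Distances-nonneg a) b λ { r (h , Hh , r≈) → ≤-respʳ (sym r≈) (lb h Hh) }

record NormedSpace (R : Reals ℓ) : Set (suc ℓ) where
  open Reals R
  field
    leftModule : LeftModule ring ℓ ℓ

  open LeftModule leftModule public
    renaming (Carrierᴹ to Carrier)

  open AbelianGroup +ᴹ-abelianGroup public using () renaming (_-_ to _-ᴹ_)

  field
    ‖_‖            : Carrier → ℝ
    ‖‖-cong        : ∀ {v w} → v ≈ᴹ w → ‖ v ‖ ≈ ‖ w ‖
    ‖‖-nonneg      : ∀ v → 0# ≤ ‖ v ‖
    ‖‖-definite    : ∀ {v} → ‖ v ‖ ≈ 0# → v ≈ᴹ 0ᴹ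
    ‖‖-homogeneous : ∀ t v → ‖ t *ₗ v ‖ ≈ ∣ t ∣ * ‖ v ‖
    ‖‖-triangle    : ∀ v w → ‖ v +ᴹ w ‖ ≤ ‖ v ‖ + ‖ w ‖

module _ {R : Reals ℓ} where
  open Reals R
  open RealProperties R

  module _ (V : NormedSpace R) where
    open NormedSpace V
    open RawMonoidDefs +ᴹ-rawMonoid using (sum)
    private module P = GroupProperties +ᴹ-abelianGroup

    linearCombination : ∀ {d} → (Fin d → ℝ) → (Fin d → Carrier) → Carrier
    linearCombination c b = sum λ i → c i *ₗ b i

    LinearlyIndependent Spanning : ∀ {d} → (Fin d → Carrier) → Set ℓ
    LinearlyIndependent b =
      ∀ c → linearCombination c b ≈ᴹ 0ᴹ → ∀ i → c i ≈ 0#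
    Spanning b = ∀ v → ∃ λ c → v ≈ᴹ linearCombination c b

    HasDimension : ℕ → Set ℓ
    HasDimension d = Σ (Fin d → Carrier) λ b → LinearlyIndependent b × Spanning b

    -- A packing is a finite family rather than a set; separation makes it
    -- injective.
    IsPacking : ∀ {k} → (Fin k → Carrier) → Set ℓ
    IsPacking s = (∀ i → ‖ s i ‖ < 1#) × (∀ i j → i ≢ j → 1# ≤ ‖ s i -ᴹ s j ‖)

    -- p is the maximal cardinality of a packing.
    IsPackingNumber : ℕ → Set ℓ
    IsPackingNumber p =
      (Σ (Fin p → Carrier) IsPacking) ×
      (∀ {k} (s : Fin k → Carrier) → IsPacking s → k ℕ.≤ p)

    record Subspace : Set (suc ℓ) where
      field
        member    : Pred Carrier ℓ
        resp      : ∀ {v w} → v ≈ᴹ w → member v → member w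
        0-closed  : member 0ᴹ
        +-closed  : ∀ {v w} → member v → member w → member (v +ᴹ w)
        *ₗ-closed : ∀ t {v} → member v → member (t *ₗ v)

    -1*v≈-v : ∀ v → (- 1#) *ₗ v ≈ᴹ -ᴹ v
    -1*v≈-v v = P.inverseˡ-unique _ v (begin
      (- 1#) *ₗ v +ᴹ v         ≈⟨ +ᴹ-congˡ (*ₗ-identityˡ v) ⟨
      (- 1#) *ₗ v +ᴹ 1# *ₗ v   ≈⟨ *ₗ-distribʳ v (- 1#) 1# ⟨
      (- 1# + 1#) *ₗ v         ≈⟨ *ₗ-cong (-‿inverseˡ 1#) ≈ᴹ-refl ⟩
      0# *ₗ v                  ≈⟨ *ₗ-zeroˡ v ⟩
      0ᴹ                       ∎)
      where open SetoidReasoning ≈ᴹ-setoid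

    *ₗ-distrib-- : ∀ t v w → t *ₗ (v -ᴹ w) ≈ᴹ t *ₗ v -ᴹ t *ₗ w
    *ₗ-distrib-- t v w = ≈ᴹ-trans (*ₗ-distribˡ t v (-ᴹ w)) (+ᴹ-congˡ
      (P.inverseˡ-unique _ (t *ₗ w) (begin
        t *ₗ (-ᴹ w) +ᴹ t *ₗ w ≈⟨ *ₗ-distribˡ t (-ᴹ w) w ⟨
        t *ₗ (-ᴹ w +ᴹ w)      ≈⟨ *ₗ-congˡ (-ᴹ‿inverseˡ w) ⟩
        t *ₗ 0ᴹ               ≈⟨ *ₗ-zeroʳ t ⟩
        0ᴹ                    ∎)))
      where open SetoidReasoning ≈ᴹ-setoid

    module _ (W : Subspace) where
      open Subspace W

      neg-closed : ∀ {v} → member v → member (-ᴹ v)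
      neg-closed {v} Wv = resp (-1*v≈-v v) (*ₗ-closed (- 1#) Wv)

      subgroup : Subgroup +ᴹ-abelianGroup
      subgroup = record
        { member = member ; resp = resp ; ε-closed = 0-closed
        ; ∙-closed = +-closed ; ⁻¹-closed = neg-closed }

      -- W itself, with the norm of V.
      subspaceSpace : NormedSpace R
      subspaceSpace = record
        { leftModule = record
          { Carrierᴹ = Σ Carrier member
          ; _≈ᴹ_ = λ v w → proj₁ v ≈ᴹ proj₁ w
          ; _+ᴹ_ = λ v w → proj₁ v +ᴹ proj₁ w , +-closed (proj₂ v) (proj₂ w)
          ; _*ₗ_ = λ t v → t *ₗ proj₁ v , *ₗ-closed t (proj₂ v)
          ; 0ᴹ = 0ᴹ , 0-closed
          ; -ᴹ_ = λ v → -ᴹ proj₁ v , neg-closed (proj₂ v)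
          ; isLeftModule = record
            { isLeftSemimodule = record
              { +ᴹ-isCommutativeMonoid = record
                { isMonoid = record
                  { isSemigroup = record
                    { isMagma = record
                      { isEquivalence = record
                        { refl = ≈ᴹ-refl ; sym = ≈ᴹ-sym ; trans = ≈ᴹ-trans }
                      ; ∙-cong = +ᴹ-cong
                      }
                    ; assoc = λ x y z → +ᴹ-assoc _ _ _
                    }
                  ; identity = (λ x → +ᴹ-identityˡ _) , (λ x → +ᴹ-identityʳ _)
                  }
                ; comm = λ x y → +ᴹ-comm _ _
                }
              ; isPreleftSemimodule = record
                { *ₗ-cong = *ₗ-cong
                ; *ₗ-zeroˡ = λ x → *ₗ-zeroˡ _
                ; *ₗ-distribʳ = λ x s t → *ₗ-distribʳ _ s t
                ; *ₗ-identityˡ = λ x → *ₗ-identityˡ _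
                ; *ₗ-assoc = λ s t x → *ₗ-assoc s t _
                ; *ₗ-zeroʳ = *ₗ-zeroʳ
                ; *ₗ-distribˡ = λ t x y → *ₗ-distribˡ t _ _
                }
              }
            ; -ᴹ‿cong = -ᴹ‿cong
            ; -ᴹ‿inverse = (λ x → -ᴹ‿inverseˡ _) , (λ x → -ᴹ‿inverseʳ _)
            }
          }
        ; ‖_‖ = λ v → ‖ proj₁ v ‖
        ; ‖‖-cong = ‖‖-cong
        ; ‖‖-nonneg = λ v → ‖‖-nonneg _
        ; ‖‖-definite = ‖‖-definite
        ; ‖‖-homogeneous = λ t v → ‖‖-homogeneous t _
        ; ‖‖-triangle = λ v w → ‖‖-triangle _ _
        }

      IsClosedSubspace : Set ℓ
      IsClosedSubspace =
        ∀ v → (∀ ε → 0# < ε → ∃ λ w → member w × ‖ v -ᴹ w ‖ < ε) → member v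

      quotientModule : LeftModule ring ℓ ℓ
      quotientModule = record
        { Carrierᴹ = Carrier
        ; _≈ᴹ_ = Q._≈_
        ; _+ᴹ_ = _+ᴹ_
        ; _*ₗ_ = _*ₗ_
        ; 0ᴹ = 0ᴹ
        ; -ᴹ_ = -ᴹ_
        ; isLeftModule = record
          { isLeftSemimodule = record
            { +ᴹ-isCommutativeMonoid = Q.isCommutativeMonoid
            ; isPreleftSemimodule = record
              { *ₗ-cong = λ {s} {t} {v} {w} s≈t p → resp
                  (≈ᴹ-trans (*ₗ-distrib-- s v w)
                    (+ᴹ-congˡ (-ᴹ‿cong (*ₗ-cong s≈t ≈ᴹ-refl))))
                  (*ₗ-closed s p)
              ; *ₗ-zeroˡ = λ x → lift (*ₗ-zeroˡ x)
              ; *ₗ-distribʳ = λ x s t → lift (*ₗ-distribʳ x s t)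
              ; *ₗ-identityˡ = λ x → lift (*ₗ-identityˡ x)
              ; *ₗ-assoc = λ s t x → lift (*ₗ-assoc s t x)
              ; *ₗ-zeroʳ = λ t → lift (*ₗ-zeroʳ t)
              ; *ₗ-distribˡ = λ t x y → lift (*ₗ-distribˡ t x y)
              }
            }
          ; -ᴹ‿cong = Q.⁻¹-cong
          ; -ᴹ‿inverse = Q.inverse
          }
        }
        where
        module Q = AbelianGroup (quotientGroup +ᴹ-abelianGroup subgroup)
        lift : ∀ {x y} → x ≈ᴹ y → x Q.≈ y
        lift p = resp (≈ᴹ-sym (P.x≈y⇒x∙y⁻¹≈ε p)) 0-closed

      module _ (em : ExcludedMiddle ℓ) (closed : IsClosedSubspace) where
        private
          open QuotientNorm R +ᴹ-abelianGroup

          q : Carrier → ℝ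
          q = quotientNorm ‖_‖ ‖‖-nonneg subgroup

          q-≤ : ∀ v {w} → member w → q v ≤ ‖ v -ᴹ w ‖
          q-≤ = quotientNorm-≤ ‖_‖ ‖‖-nonneg subgroup

          q-greatest : ∀ v b → (∀ w → member w → b ≤ ‖ v -ᴹ w ‖) → b ≤ q v
          q-greatest = quotientNorm-greatest ‖_‖ ‖‖-nonneg subgroup

          q-nonneg : ∀ v → 0# ≤ q v
          q-nonneg v = q-greatest v 0# λ w _ → ‖‖-nonneg _

          q-cong-≤ : ∀ {v v'} → member (v' -ᴹ v) → q v' ≤ q v
          q-cong-≤ {v} {v'} p = q-greatest v _ λ w Ww →
            ≤-respʳ (‖‖-cong (shift w)) (q-≤ v' (+-closed Ww p))
            where
            shift : ∀ w → v' -ᴹ (w +ᴹ (v' -ᴹ v)) ≈ᴹ v -ᴹ w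
            shift w = begin
              v' -ᴹ (w +ᴹ c)             ≈⟨ +ᴹ-congʳ (P.//-rightDividesˡ v v') ⟨
              (c +ᴹ v) -ᴹ (w +ᴹ c)       ≈⟨ +ᴹ-congʳ (+ᴹ-comm c v) ⟩
              (v +ᴹ c) -ᴹ (w +ᴹ c)       ≈⟨ P.∙-//-distrib v c w c ⟩
              (v -ᴹ w) +ᴹ (c -ᴹ c)       ≈⟨ +ᴹ-congˡ (-ᴹ‿inverseʳ c) ⟩
              (v -ᴹ w) +ᴹ 0ᴹ             ≈⟨ +ᴹ-identityʳ _ ⟩
              v -ᴹ w                     ∎
              where
              open SetoidReasoning ≈ᴹ-setoid
              c = v' -ᴹ v

          q-cong : ∀ {v v'} → member (v -ᴹ v') → q v ≈ q v'
          q-cong {v} {v'} p = antisym (q-cong-≤ p)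
            (q-cong-≤ (resp (P.⁻¹-anti-homo-// v v') (neg-closed p)))

          q-respects : ∀ {v v'} → v ≈ᴹ v' → q v ≈ q v'
          q-respects p = q-cong (resp (≈ᴹ-sym (P.x≈y⇒x∙y⁻¹≈ε p)) 0-closed)

          q-zero : q 0ᴹ ≈ 0#
          q-zero = antisym (≤-respʳ ‖0-0‖≈0 (q-≤ 0ᴹ 0-closed)) (q-nonneg 0ᴹ)
            where
            ‖0-0‖≈0 : ‖ 0ᴹ -ᴹ 0ᴹ ‖ ≈ 0#
            ‖0-0‖≈0 = begin
              ‖ 0ᴹ -ᴹ 0ᴹ ‖  ≈⟨ ‖‖-cong (≈ᴹ-trans (P.x//ε≈x 0ᴹ) (≈ᴹ-sym (*ₗ-zeroˡ 0ᴹ))) ⟩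
              ‖ 0# *ₗ 0ᴹ ‖  ≈⟨ ‖‖-homogeneous 0# 0ᴹ ⟩
              ∣ 0# ∣ * ‖ 0ᴹ ‖ ≈⟨ *-congʳ (0≤x⇒∣x∣≈x ≤-refl) ⟩
              0# * ‖ 0ᴹ ‖   ≈⟨ zeroˡ _ ⟩
              0#            ∎
              where open SetoidReasoning setoid

          q-definite : ∀ {v} → q v ≈ 0# → member (v -ᴹ 0ᴹ)
          q-definite {v} qv≈0 = resp (≈ᴹ-sym (P.x//ε≈x v)) (closed v near)
            where
            near : ∀ ε → 0# < ε → ∃ λ w → member w × ‖ v -ᴹ w ‖ < ε
            near ε (0≤ε , 0≉ε) with em {P = ∃ λ w → member w × ‖ v -ᴹ w ‖ < ε}
            ... | yes found = found
            ... | no none = contradiction (antisym 0≤ε (≤-respʳ qv≈0 (q-greatest v ε far))) 0≉ε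
              where
              far : ∀ w → member w → ε ≤ ‖ v -ᴹ w ‖
              far w Ww with total ε ‖ v -ᴹ w ‖ | em {P = ‖ v -ᴹ w ‖ ≈ ε}
              ... | inj₁ le | _      = le
              ... | inj₂ ge | yes eq = ≤-reflexive (sym eq)
              ... | inj₂ ge | no neq = contradiction (w , Ww , ge , neq) none

          q-scale-≤ : ∀ t v → ∣ t ∣ * q v ≤ q (t *ₗ v)
          q-scale-≤ t v with em {P = t ≈ 0#}
          ... | yes t≈0 = ≤-respˡ (sym (begin
              ∣ t ∣ * q v   ≈⟨ *-congʳ (∣∣-cong t≈0) ⟩
              ∣ 0# ∣ * q v  ≈⟨ *-congʳ (0≤x⇒∣x∣≈x ≤-refl) ⟩
              0# * q v      ≈⟨ zeroˡ _ ⟩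
              0#            ∎)) (q-nonneg _)
            where open SetoidReasoning setoid
          ... | no t≉0 = q-greatest (t *ₗ v) _ λ w Ww → begin
              ∣ t ∣ * q v                        ≤⟨ *-monoˡ-≤ (0≤∣x∣ t) (q-≤ v (*ₗ-closed s Ww)) ⟩
              ∣ t ∣ * ‖ v -ᴹ s *ₗ w ‖            ≈⟨ ‖‖-homogeneous t _ ⟨
              ‖ t *ₗ (v -ᴹ s *ₗ w) ‖             ≈⟨ ‖‖-cong (*ₗ-distrib-- t v (s *ₗ w)) ⟩
              ‖ t *ₗ v -ᴹ t *ₗ (s *ₗ w) ‖        ≈⟨ ‖‖-cong (+ᴹ-congˡ (-ᴹ‿cong (cancel w))) ⟩
              ‖ t *ₗ v -ᴹ w ‖                    ∎
            where
            open PosetReasoning poset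
            s = proj₁ (inverse t t≉0)
            cancel : ∀ w → t *ₗ (s *ₗ w) ≈ᴹ w
            cancel w = ≈ᴹ-trans (≈ᴹ-sym (*ₗ-assoc t s w))
              (≈ᴹ-trans (*ₗ-cong (proj₂ (inverse t t≉0)) ≈ᴹ-refl) (*ₗ-identityˡ w))

          q-homogeneous : ∀ t v → q (t *ₗ v) ≈ ∣ t ∣ * q v
          q-homogeneous t v with em {P = t ≈ 0#}
          ... | yes t≈0 = begin
              q (t *ₗ v)    ≈⟨ q-respects (≈ᴹ-trans (*ₗ-cong t≈0 ≈ᴹ-refl) (*ₗ-zeroˡ v)) ⟩
              q 0ᴹ          ≈⟨ q-zero ⟩
              0#            ≈⟨ zeroˡ _ ⟨
              0# * q v      ≈⟨ *-congʳ (0≤x⇒∣x∣≈x ≤-refl) ⟨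
              ∣ 0# ∣ * q v  ≈⟨ *-congʳ (∣∣-cong t≈0) ⟨
              ∣ t ∣ * q v   ∎
            where open SetoidReasoning setoid
          ... | no t≉0 = antisym (begin
              q (t *ₗ v)                       ≈⟨ *-identityˡ _ ⟨
              1# * q (t *ₗ v)                  ≈⟨ *-congʳ ∣t∣∣s∣≈1 ⟨
              (∣ t ∣ * ∣ s ∣) * q (t *ₗ v)     ≈⟨ *-assoc _ _ _ ⟩
              ∣ t ∣ * (∣ s ∣ * q (t *ₗ v))     ≤⟨ *-monoˡ-≤ (0≤∣x∣ t) (q-scale-≤ s (t *ₗ v)) ⟩
              ∣ t ∣ * q (s *ₗ (t *ₗ v))        ≈⟨ *-congˡ (q-respects cancel) ⟩
              ∣ t ∣ * q v                      ∎) (q-scale-≤ t v)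
            where
            open PosetReasoning poset
            s = proj₁ (inverse t t≉0)
            ts≈1 = proj₂ (inverse t t≉0)
            ∣t∣∣s∣≈1 : ∣ t ∣ * ∣ s ∣ ≈ 1#
            ∣t∣∣s∣≈1 = trans (∣x∣*∣y∣≈∣x*y∣ t s) (trans (∣∣-cong ts≈1) (0≤x⇒∣x∣≈x 0≤1))
            cancel : s *ₗ (t *ₗ v) ≈ᴹ v
            cancel = ≈ᴹ-trans (≈ᴹ-sym (*ₗ-assoc s t v))
              (≈ᴹ-trans (*ₗ-cong (trans (*-comm s t) ts≈1) ≈ᴹ-refl) (*ₗ-identityˡ v))

          q-triangle : ∀ v w → q (v +ᴹ w) ≤ q v + q w
          q-triangle v w = x-z≤y⇒x≤y+z (q-greatest v _ λ x Wx →
            x≤y+z⇒x-z≤y (≤-respʳ (+-comm (q w) ‖ v -ᴹ x ‖)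
              (x-z≤y⇒x≤y+z (q-greatest w _ λ y Wy →
                x≤y+z⇒x-z≤y (split x y Wx Wy)))))
            where
            open PosetReasoning poset
            split : ∀ x y → member x → member y →
                    q (v +ᴹ w) ≤ ‖ w -ᴹ y ‖ + ‖ v -ᴹ x ‖
            split x y Wx Wy = begin
              q (v +ᴹ w)                    ≤⟨ q-≤ _ (+-closed Wx Wy) ⟩
              ‖ (v +ᴹ w) -ᴹ (x +ᴹ y) ‖      ≈⟨ ‖‖-cong (P.∙-//-distrib v w x y) ⟩
              ‖ (v -ᴹ x) +ᴹ (w -ᴹ y) ‖      ≤⟨ ‖‖-triangle _ _ ⟩
              ‖ v -ᴹ x ‖ + ‖ w -ᴹ y ‖       ≈⟨ +-comm _ _ ⟩
              ‖ w -ᴹ y ‖ + ‖ v -ᴹ x ‖       ∎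

        quotientSpace : NormedSpace R
        quotientSpace = record
          { leftModule = quotientModule
          ; ‖_‖ = quotientNorm ‖_‖ ‖‖-nonneg subgroup
          ; ‖‖-cong = q-cong
          ; ‖‖-nonneg = q-nonneg
          ; ‖‖-definite = q-definite
          ; ‖‖-homogeneous = q-homogeneous
          ; ‖‖-triangle = q-triangle
          }

    data Span (T : Pred Carrier ℓ) : Pred Carrier ℓ where
      generator  : ∀ {v} → T v → Span T v
      span-resp  : ∀ {v w} → v ≈ᴹ w → Span T v → Span T w
      span-zero  : Span T 0ᴹ
      span-add   : ∀ {v w} → Span T v → Span T w → Span T (v +ᴹ w)
      span-scale : ∀ t {v} → Span T v → Span T (t *ₗ v)

    span : Pred Carrier ℓ → Subspace
    span T = record
      { member = Span T ; resp = span-resp ; 0-closed = span-zero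
      ; +-closed = span-add ; *ₗ-closed = span-scale }

    -- An inner product inducing the given norm; positive definiteness follows
    -- from norm-sq and ‖‖-definite.
    record InnerProduct : Set (suc ℓ) where
      field
        ⟨_,_⟩     : Carrier → Carrier → ℝ
        ⟨,⟩-cong  : ∀ {v v' w w'} → v ≈ᴹ v' → w ≈ᴹ w' → ⟨ v , w ⟩ ≈ ⟨ v' , w' ⟩
        symmetric : ∀ v w → ⟨ v , w ⟩ ≈ ⟨ w , v ⟩
        additive  : ∀ u v w → ⟨ u +ᴹ v , w ⟩ ≈ ⟨ u , w ⟩ + ⟨ v , w ⟩
        scalar    : ∀ t v w → ⟨ t *ₗ v , w ⟩ ≈ t * ⟨ v , w ⟩
        norm-sq   : ∀ v → ‖ v ‖ * ‖ v ‖ ≈ ⟨ v , v ⟩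

record UltrametricGroup (R : Reals ℓ) : Set (suc ℓ) where
  open Reals R using (ℝ; 0#; _⊔_) renaming (_≈_ to _≈ᴿ_; _≤_ to _≤ᴿ_)
  field
    abelianGroup : AbelianGroup ℓ ℓ

  open AbelianGroup abelianGroup public

  field
    dist                 : Carrier → Carrier → ℝ
    isUltrametric        : IsGeneralMetric _≈_ _≈ᴿ_ _≤ᴿ_ 0# _⊔_ dist
    translationInvariant : TranslationInvariant _≈ᴿ_ _∙_ dist

  ∣_∣ᵁ : Carrier → ℝ
  ∣ u ∣ᵁ = dist u ε

module _ {R : Reals ℓ} (V : NormedSpace R) (U : UltrametricGroup R) where
  open Reals R
  private
    module V = NormedSpace V
    module U = UltrametricGroup U

  productGroup : AbelianGroup ℓ ℓ
  productGroup = DirectProduct.abelianGroup V.+ᴹ-abelianGroup U.abelianGroup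

  open AbelianGroup productGroup using () renaming (Carrier to V×U; _-_ to _-ᴾ_)

  maxNorm : V×U → ℝ
  maxNorm (v , u) = V.‖ v ‖ ⊔ U.∣ u ∣ᵁ

  maxNorm-nonneg : ∀ a → 0# ≤ maxNorm a
  maxNorm-nonneg (v , u) = ≤-trans (V.‖‖-nonneg v) (x≤x⊔y _ _)

  IsClosed : Subgroup productGroup → Set ℓ
  IsClosed Λ = ∀ a → (∀ ε → 0# < ε → ∃ λ b → member b × maxNorm (a -ᴾ b) < ε) → member a
    where open Subgroup Λ

  module _ (Λ : Subgroup productGroup) where
    open Subgroup Λ

    X : AbelianGroup ℓ ℓ
    X = quotientGroup productGroup Λ

    private module X = AbelianGroup X

    ‖_‖ˣ : X.Carrier → ℝ
    ‖_‖ˣ = QuotientNorm.quotientNorm R productGroup maxNorm maxNorm-nonneg Λ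

    distˣ : X.Carrier → X.Carrier → ℝ
    distˣ x y = ‖ x X.- y ‖ˣ

    ρ : X.Carrier → ℕ → ℝ
    ρ α q = distˣ (q ·ˣ α) X.ε
      where open RawMonoidDefs X.rawMonoid using () renaming (_×_ to _·ˣ_)

    -- IsDenominator α n q: the best-return sequence of α has an n-th term
    -- (counting from 1), and that term is q.
    data IsDenominator (α : X.Carrier) : ℕ → ℕ → Set ℓ where
      first : IsDenominator α 1 1
      next  : ∀ {n q q'} → IsDenominator α n q →
              q ℕ.< q' → ρ α q' < ρ α q →
              (∀ r → q ℕ.< r → ρ α r < ρ α q → q' ℕ.≤ r) →
              IsDenominator α (ℕ.suc n) q'

    W : Subspace V
    W = record
      { member = λ v → ∀ t → member (t V.*ₗ v , U.ε)
      ; resp = λ p Wv t → resp (V.*ₗ-congˡ p , U.refl) (Wv t)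
      ; 0-closed = λ t → resp (V.≈ᴹ-sym (V.*ₗ-zeroʳ t) , U.refl) ε-closed
      ; +-closed = λ {v} {w} Wv Ww t →
          resp (V.≈ᴹ-sym (V.*ₗ-distribˡ t v w) , U.identityˡ U.ε) (∙-closed (Wv t) (Ww t))
      ; *ₗ-closed = λ s {v} Wv t → resp (V.*ₗ-assoc t s v , U.refl) (Wv (t * s))
      }

    module _ (em : ExcludedMiddle ℓ) (closed : IsClosed Λ) where

      W-closed : IsClosedSubspace V W
      W-closed v near t with em {P = t ≈ 0#}
      ... | yes t≈0 = resp
              (V.≈ᴹ-sym (V.≈ᴹ-trans (V.*ₗ-cong t≈0 V.≈ᴹ-refl) (V.*ₗ-zeroˡ v)) , U.refl)
              ε-closed
      ... | no t≉0 = closed (t V.*ₗ v , U.ε) approx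
        where
        open RealProperties R
        s = proj₁ (inverse t t≉0)

        ∣t∣∣s∣≈1 : ∣ t ∣ * ∣ s ∣ ≈ 1#
        ∣t∣∣s∣≈1 = trans (∣x∣*∣y∣≈∣x*y∣ t s)
          (trans (∣∣-cong (proj₂ (inverse t t≉0))) (0≤x⇒∣x∣≈x 0≤1))

        ∣t∣[∣s∣x]≈x : ∀ x → ∣ t ∣ * (∣ s ∣ * x) ≈ x
        ∣t∣[∣s∣x]≈x x = trans (sym (*-assoc _ _ _))
          (trans (*-congʳ ∣t∣∣s∣≈1) (*-identityˡ x))

        ∣s∣[∣t∣x]≈x : ∀ x → ∣ s ∣ * (∣ t ∣ * x) ≈ x
        ∣s∣[∣t∣x]≈x x = trans (sym (*-assoc _ _ _))
          (trans (*-congʳ (trans (*-comm _ _) ∣t∣∣s∣≈1)) (*-identityˡ x))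

        maxNorm≈ : ∀ w → maxNorm ((t V.*ₗ v , U.ε) -ᴾ (t V.*ₗ w , U.ε))
                         ≈ ∣ t ∣ * V.‖ v V.-ᴹ w ‖
        maxNorm≈ w = begin
          V.‖ t V.*ₗ v V.-ᴹ t V.*ₗ w ‖ ⊔ U.∣ U.ε U.- U.ε ∣ᵁ
            ≈⟨ ⊔-cong (V.‖‖-cong (V.≈ᴹ-sym (*ₗ-distrib-- V t v w)))
                      (IsGeneralMetric.≈⇒0 U.isUltrametric (U.inverseʳ U.ε)) ⟩
          V.‖ t V.*ₗ (v V.-ᴹ w) ‖ ⊔ 0#
            ≈⟨ x≤y⇒y⊔x≈y (V.‖‖-nonneg _) ⟩
          V.‖ t V.*ₗ (v V.-ᴹ w) ‖
            ≈⟨ V.‖‖-homogeneous t _ ⟩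
          ∣ t ∣ * V.‖ v V.-ᴹ w ‖ ∎
          where open SetoidReasoning setoid

        approx : ∀ ε → 0# < ε →
                 ∃ λ b → member b × maxNorm ((t V.*ₗ v , U.ε) -ᴾ b) < ε
        approx ε (0≤ε , 0≉ε)
          with w , Ww , ≤δ , ≉δ ← near (∣ s ∣ * ε)
                 ( *-nonneg (0≤∣x∣ s) 0≤ε
                 , λ 0≈ → 0≉ε (trans (sym (zeroʳ _))
                     (trans (*-congˡ 0≈) (∣t∣[∣s∣x]≈x ε))))
          = (t V.*ₗ w , U.ε) , Ww t
          , ≤-respˡ (sym (maxNorm≈ w))
              (≤-respʳ (∣t∣[∣s∣x]≈x ε) (*-monoˡ-≤ (0≤∣x∣ t) ≤δ))
          , λ ≈ε → ≉δ (trans (sym (∣s∣[∣t∣x]≈x _))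
              (*-congˡ (trans (sym (maxNorm≈ w)) ≈ε)))

      reducedRealFactor : NormedSpace R
      reducedRealFactor = quotientSpace V W em W-closed

    module _ (ip : InnerProduct V) where
      open InnerProduct ip

      OrthogonalToW : Pred V.Carrier ℓ
      OrthogonalToW z = ∀ w → Subspace.member W w → ⟨ z , w ⟩ ≈ 0#

      -- The graph of the orthogonal projection π : V → W^⊥.
      IsProjection : Rel V.Carrier ℓ
      IsProjection v z = OrthogonalToW z × Subspace.member W (v V.-ᴹ z)

      effectiveRealFactor : NormedSpace R
      effectiveRealFactor = subspaceSpace V
        (span V λ z → ∃ λ v → ∃ λ u → member (v , u) × IsProjection v z)

{-# OPTIONS --safe #-}
module Submission where

-- If q_{n+p+1} ≤ q_n + q_{n+1}, the p + 1 times t_i = q_{n+1}, …, q_{n+p+1}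
-- differ pairwise by at most q_n.  With r = ρ(q_n), the points t_i α are
-- shorter than r, while each difference is a multiple δ α with δ ≤ q_n, so it
-- has length at least r.  Lift t_i α to (v_i , u_i) of norm below r.  The
-- ultrametric keeps |u_i - u_j| below r, so the separation must be visible in
-- the real coordinates, even after subtracting any vector of W: the v_i give
-- p + 1 points of a packing in V / W.
--
-- In the Euclidean case write v_i = w_i + e_i + t_i f with w_i ∈ W, e_i ∈ E
-- and f the component of the real coordinate of α orthogonal to both; Λ has
-- no such component, so the coefficient t_i is exact.  Then ‖e_h‖² + ‖t_h f‖² < r² ≤ ‖e_j - e_i‖² +
-- ‖(t_j - t_i) f‖², and t_j - t_i ≤ q_n ≤ t_h, so ‖e_h‖ < ‖e_j - e_i‖.

open import Defs
open import Algebra.Bundles using (AbelianGroup)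
open import Axiom.ExcludedMiddle using (ExcludedMiddle)
open import Data.Fin.Base as Fin using (Fin; zero; suc; toℕ)
open import Data.Nat.Base as ℕ using (ℕ; zero; suc)
open import Data.Product using (∃; ∃₂; _×_; _,_; proj₁; proj₂)
open import Data.Sum.Base using (inj₁; inj₂)
open import Function.Base using (_∘_)
open import Function.Metric.Structures using (IsGeneralMetric)
open import Relation.Binary.Definitions using (tri<; tri≈; tri>)
open import Relation.Binary.PropositionalEquality.Core as ≡ using (_≡_; _≢_)
open import Relation.Nullary using (¬_; yes; no)
open import Relation.Nullary.Negation using (contradiction)
open import Relation.Unary using (Pred)
import Algebra.Properties.CommutativeSemigroup as CommutativeSemigroupProperties
import Algebra.Properties.Monoid.Mult as Mult
import Algebra.Properties.Ring as RingProperties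
import Data.Fin.Properties as Fin
import Data.Nat.Properties as ℕ
import Relation.Binary.Construct.NonStrictToStrict as NonStrictToStrict
import Relation.Binary.Reasoning.PartialOrder as PosetReasoning
import Relation.Binary.Reasoning.Setoid as SetoidReasoning

-- Strict order, squares and finite minima in a complete ordered field.

module RealOrder {ℓ} (em : ExcludedMiddle ℓ) (R : Reals ℓ) where
  open Reals R hiding (zero)
  open RealProperties R
  private module S = NonStrictToStrict _≈_ _≤_

  <-≤-trans : ∀ {x y z} → x < y → y ≤ z → x < z
  <-≤-trans = S.<-≤-trans sym ≤-trans antisym ≤-respʳ

  ≤-<-trans : ∀ {x y z} → x ≤ y → y < z → x < z
  ≤-<-trans = S.≤-<-trans ≤-trans antisym ≤-respˡ

  ≮⇒≥ : ∀ {x y} → ¬ (x < y) → y ≤ x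
  ≮⇒≥ = S.≮⇒≥ sym (λ _ _ → em) ≤-reflexive total

  ≰⇒> : ∀ {x y} → ¬ (x ≤ y) → y < x
  ≰⇒> = S.≰⇒> sym ≤-reflexive total

  <⇒≱ : ∀ {x y} → x < y → ¬ (y ≤ x)
  <⇒≱ = S.<⇒≱ antisym

  ⊔-lub-< : ∀ {x y z} → x < z → y < z → x ⊔ y < z
  ⊔-lub-< {x} {y} x<z y<z with total x y
  ... | inj₁ x≤y = ≤-<-trans (≤-reflexive (x≤y⇒x⊔y≈y x≤y)) y<z
  ... | inj₂ y≤x = ≤-<-trans (≤-reflexive (x≤y⇒y⊔x≈y y≤x)) x<z

  -- This moves a lower bound on a maximum norm to the real coordinate once the ultrametric
  -- coordinate `y` is known to lie below it.
  ≤-⊔-resolveʳ : ∀ {x y z} → z ≤ x ⊔ y → y < z → z ≤ x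
  ≤-⊔-resolveʳ {x} {y} z≤ y<z with total x y
  ... | inj₁ x≤y = contradiction (≤-respʳ (x≤y⇒x⊔y≈y x≤y) z≤) (<⇒≱ y<z)
  ... | inj₂ y≤x = ≤-respʳ (x≤y⇒y⊔x≈y y≤x) z≤

  *-mono-≤ : ∀ {a b c d} → 0# ≤ a → 0# ≤ d → a ≤ b → c ≤ d → a * c ≤ b * d
  *-mono-≤ {a} {b} {c} {d} 0≤a 0≤d a≤b c≤d = begin
    a * c ≤⟨ *-monoˡ-≤ 0≤a c≤d ⟩
    a * d ≈⟨ *-comm a d ⟩
    d * a ≤⟨ *-monoˡ-≤ 0≤d a≤b ⟩
    d * b ≈⟨ *-comm d b ⟩
    b * d ∎
    where open PosetReasoning poset

  *-monoˡ-< : ∀ {s x y} → 0# < s → x < y → s * x < s * y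
  -- The weak order already gives s x ≤ s y, so s y ≤ s x would force equality, and the inverse of
  -- `s` would cancel it to x ≈ y.
  *-monoˡ-< {s} {x} {y} (0≤s , 0≉s) x<y = ≰⇒> λ sy≤sx →
    let z , sz≈1 = inverse s (0≉s ∘ sym)
        open SetoidReasoning setoid
        cancel : ∀ w → z * (s * w) ≈ w
        cancel w = begin
          z * (s * w) ≈⟨ *-assoc z s w ⟨
          (z * s) * w ≈⟨ *-congʳ (trans (*-comm z s) sz≈1) ⟩
          1# * w      ≈⟨ *-identityˡ w ⟩
          w           ∎
    in proj₂ x<y (begin
      x           ≈⟨ cancel x ⟨
      z * (s * x) ≈⟨ *-congˡ (antisym (*-monoˡ-≤ 0≤s (proj₁ x<y)) sy≤sx) ⟩
      z * (s * y) ≈⟨ cancel y ⟩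
      y           ∎)

  square-mono-< : ∀ {x y} → 0# ≤ x → x < y → x * x < y * y
  square-mono-< {x} {y} 0≤x x<y = begin-strict
    x * x ≤⟨ *-mono-≤ 0≤x (≤-trans 0≤x (proj₁ x<y)) ≤-refl (proj₁ x<y) ⟩
    x * y ≈⟨ *-comm x y ⟩
    y * x <⟨ *-monoˡ-< (≤-<-trans 0≤x x<y) x<y ⟩
    y * y ∎
    where open PosetReasoning poset

  square-mono-≤ : ∀ {x y} → 0# ≤ x → x ≤ y → x * x ≤ y * y
  square-mono-≤ 0≤x x≤y = *-mono-≤ 0≤x (≤-trans 0≤x x≤y) x≤y x≤y

  square-cancel-< : ∀ {x y} → 0# ≤ y → x * x < y * y → x < y
  square-cancel-< 0≤y x²<y² =
    ≰⇒> λ y≤x → <⇒≱ x²<y² (square-mono-≤ 0≤y y≤x)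

  -- Serves to drop the drift terms `y` and `w` from a comparison of squared norms.
  x+y<z+w∧w≤y⇒x<z : ∀ {x y z w} → x + y < z + w → w ≤ y → x < z
  x+y<z+w∧w≤y⇒x<z x+y<z+w w≤y =
    ≰⇒> λ z≤x → <⇒≱ x+y<z+w (+-mono-≤ z≤x w≤y)

  x*x≈0⇒x≈0 : ∀ {x} → x * x ≈ 0# → x ≈ 0#
  x*x≈0⇒x≈0 {x} x²≈0 with em {P = x ≈ 0#}
  ... | yes x≈0 = x≈0
  ... | no x≉0 with z , xz≈1 ← inverse x x≉0 = begin
    x           ≈⟨ *-identityʳ x ⟨
    x * 1#      ≈⟨ *-congˡ xz≈1 ⟨
    x * (x * z) ≈⟨ *-assoc x x z ⟨
    (x * x) * z ≈⟨ *-congʳ x²≈0 ⟩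
    0# * z      ≈⟨ zeroˡ z ⟩
    0#          ∎
    where open SetoidReasoning setoid

  positive-inverse : ∀ {t} → 0# < t → ∃ λ s → 0# < s × s * t ≈ 1#
  positive-inverse {t} (0≤t , 0≉t) with s , ts≈1 ← inverse t (0≉t ∘ sym) =
    s , ≰⇒> s≰0 , trans (*-comm s t) ts≈1
    where
    s≰0 : ¬ (s ≤ 0#)
    s≰0 s≤0 = 0≉1 (antisym 0≤1 (begin
      1#     ≈⟨ ts≈1 ⟨
      t * s  ≤⟨ *-monoˡ-≤ 0≤t s≤0 ⟩
      t * 0# ≈⟨ zeroʳ t ⟩
      0#     ∎))
      where open PosetReasoning poset

  -- Induction on `k`, keeping the smaller of two candidates. The result is always one of the
  -- supplied values, so it satisfies `P`; the hypothesis on `Q` covers the constraints for which it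
  -- is smaller than the value supplied. `∃ P` answers the case without constraints.
  common-lower-bound :
    ∀ {a b k} {P : Pred ℝ a} {Q : Fin k → Pred ℝ b} →
    (∀ i {s t} → s ≤ t → Q i t → Q i s) →
    ∃ P → (∀ i → ∃ λ t → P t × Q i t) → ∃ λ t → P t × (∀ i → Q i t)
  common-lower-bound {k = zero} _ (t , Pt) _ = t , Pt , λ ()
  common-lower-bound {k = suc k} down nonempty bound
    with bound zero | common-lower-bound (down ∘ suc) nonempty (bound ∘ suc)
  ... | s , Ps , Qs | t , Pt , Qt with total s t
  ... | inj₁ s≤t = s , Ps , λ { zero → Qs ; (suc i) → down (suc i) s≤t (Qt i) }
  ... | inj₂ t≤s = t , Pt , λ { zero → down zero t≤s Qs ; (suc i) → Qt i }

  open Mult +-monoid using (×-homo-+) renaming (_×_ to _·_)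

  fromℕ : ℕ → ℝ
  fromℕ n = n · 1#

  fromℕ-homo-+ : ∀ m n → fromℕ (m ℕ.+ n) ≈ fromℕ m + fromℕ n
  fromℕ-homo-+ = ×-homo-+ 1#

  fromℕ-nonneg : ∀ n → 0# ≤ fromℕ n
  fromℕ-nonneg zero    = ≤-refl
  fromℕ-nonneg (suc n) = ≤-respˡ (+-identityˡ 0#) (+-mono-≤ 0≤1 (fromℕ-nonneg n))

  fromℕ-mono-≤ : ∀ {m n} → m ℕ.≤ n → fromℕ m ≤ fromℕ n
  fromℕ-mono-≤ {n = n} ℕ.z≤n = fromℕ-nonneg n
  fromℕ-mono-≤ (ℕ.s≤s m≤n)   = +-monoʳ-≤ 1# (fromℕ-mono-≤ m≤n)

-- Packings obtained from spread families in a normed space.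

module Packing {ℓ} (em : ExcludedMiddle ℓ) (R : Reals ℓ) (Y : NormedSpace R) where
  open Reals R hiding (zero)
  open RealProperties R
  open RealOrder em R
  open NormedSpace Y
  private module Y = GroupProperties +ᴹ-abelianGroup

  ‖‖-neg : ∀ v → ‖ -ᴹ v ‖ ≈ ‖ v ‖
  ‖‖-neg v = begin
    ‖ -ᴹ v ‖             ≈⟨ ‖‖-cong (-1*v≈-v Y v) ⟨
    ‖ (- 1#) *ₗ v ‖      ≈⟨ ‖‖-homogeneous (- 1#) v ⟩
    ∣ - 1# ∣ * ‖ v ‖     ≈⟨ *-congʳ (x≤0⇒∣x∣≈-x (0≤x⇒-x≤0 0≤1)) ⟩
    (- (- 1#)) * ‖ v ‖   ≈⟨ *-congʳ (RingProperties.-‿involutive ring 1#) ⟩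
    1# * ‖ v ‖           ≈⟨ *-identityˡ _ ⟩
    ‖ v ‖                ∎
    where open SetoidReasoning setoid

  ‖‖-sym : ∀ v w → ‖ v -ᴹ w ‖ ≈ ‖ w -ᴹ v ‖
  ‖‖-sym v w = trans (sym (‖‖-neg (v -ᴹ w))) (‖‖-cong (Y.⁻¹-anti-homo-// v w))

  -- Multiplication by 1/t turns radius t into radius 1. Separation is asked only for i < j, the
  -- order in which return times increase; symmetry of the norm supplies the other pairs.
  scaled-packing : ∀ {k t} (s : Fin k → Carrier) → 0# < t → (∀ i → ‖ s i ‖ < t) →
                   (∀ i j → i Fin.< j → t ≤ ‖ s j -ᴹ s i ‖) →
                   ∃ (IsPacking Y {k})
  scaled-packing {t = t} s 0<t short apart
    with c , 0<c , ct≈1 ← positive-inverse 0<t = (λ i → c *ₗ s i) , inside , separated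
    where
    open PosetReasoning poset

    ‖c*v‖≈ : ∀ v → ‖ c *ₗ v ‖ ≈ c * ‖ v ‖
    ‖c*v‖≈ v = trans (‖‖-homogeneous c v) (*-congʳ (0≤x⇒∣x∣≈x (proj₁ 0<c)))

    inside : ∀ i → ‖ c *ₗ s i ‖ < 1#
    inside i = begin-strict
      ‖ c *ₗ s i ‖ ≈⟨ ‖c*v‖≈ (s i) ⟩
      c * ‖ s i ‖  <⟨ *-monoˡ-< 0<c (short i) ⟩
      c * t        ≈⟨ ct≈1 ⟩
      1#           ∎

    separated< : ∀ i j → i Fin.< j → 1# ≤ ‖ c *ₗ s j -ᴹ c *ₗ s i ‖
    separated< i j i<j = begin
      1#                          ≈⟨ ct≈1 ⟨
      c * t                       ≤⟨ *-monoˡ-≤ (proj₁ 0<c) (apart i j i<j) ⟩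
      c * ‖ s j -ᴹ s i ‖          ≈⟨ ‖c*v‖≈ _ ⟨
      ‖ c *ₗ (s j -ᴹ s i) ‖       ≈⟨ ‖‖-cong (*ₗ-distrib-- Y c (s j) (s i)) ⟩
      ‖ c *ₗ s j -ᴹ c *ₗ s i ‖    ∎

    separated : ∀ i j → i ≢ j → 1# ≤ ‖ c *ₗ s i -ᴹ c *ₗ s j ‖
    separated i j i≢j with Fin.<-cmp i j
    ... | tri< i<j _ _ = ≤-respʳ (‖‖-sym _ _) (separated< i j i<j)
    ... | tri≈ _ i≡j _ = contradiction i≡j i≢j
    ... | tri> _ _ j<i = separated< j i j<i

  -- The radius t is the least of the finitely many distances, so that in the
  -- Euclidean case no square root has to be taken; r covers a one-point family.
  spread⇒≤packingNumber :
    ∀ {p k r} → IsPackingNumber Y p → (s : Fin (suc k) → Carrier) →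
    (∀ i → ‖ s i ‖ < r) →
    (∀ h i j → i Fin.< j → ‖ s h ‖ < ‖ s j -ᴹ s i ‖) →
    suc k ℕ.≤ p
  spread⇒≤packingNumber {r = r} (_ , maximal) s short apart =
    let t , large , small = common-lower-bound rowDown (r , short) row
        -- The radius is positive because it exceeds the length of the point `s zero`; this is why
        -- the family is indexed by `suc k`.
        σ , packing = scaled-packing s (≤-<-trans (‖‖-nonneg (s zero)) (large zero))
          large small
    in maximal σ packing
    where
    Exceeds : Pred ℝ _
    Exceeds t = ∀ h → ‖ s h ‖ < t

    pair : ∀ i j → ∃ λ t → Exceeds t × (i Fin.< j → t ≤ ‖ s j -ᴹ s i ‖)
    pair i j with i Fin.<? j
    ... | yes i<j = ‖ s j -ᴹ s i ‖ , (λ h → apart h i j i<j) , λ _ → ≤-refl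
    ... | no i≮j  = r , short , λ i<j → contradiction i<j i≮j

    row : ∀ i → ∃ λ t → Exceeds t × (∀ j → i Fin.< j → t ≤ ‖ s j -ᴹ s i ‖)
    row i = common-lower-bound (λ j s≤t below i<j → ≤-trans s≤t (below i<j))
      (r , short) (pair i)

    rowDown : ∀ i {t t'} → t ≤ t' → (∀ j → i Fin.< j → t' ≤ ‖ s j -ᴹ s i ‖) →
              ∀ j → i Fin.< j → t ≤ ‖ s j -ᴹ s i ‖
    rowDown i t≤t' below j i<j = ≤-trans t≤t' (below j i<j)

-- Orthogonal projection onto subspaces in an inner-product space.

module OrthogonalProjection {ℓ} (em : ExcludedMiddle ℓ) {R : Reals ℓ} (V : NormedSpace R)
  (ip : InnerProduct V) where

  open Reals R hiding (zero)
  open RealProperties R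
  open RealOrder em R
  open NormedSpace V
  open InnerProduct ip
  private module G = GroupProperties +ᴹ-abelianGroup

  orthogonal-zeroˡ : ∀ w → ⟨ 0ᴹ , w ⟩ ≈ 0#
  orthogonal-zeroˡ w = begin
    ⟨ 0ᴹ , w ⟩        ≈⟨ ⟨,⟩-cong (*ₗ-zeroˡ 0ᴹ) ≈ᴹ-refl ⟨
    ⟨ 0# *ₗ 0ᴹ , w ⟩  ≈⟨ scalar 0# 0ᴹ w ⟩
    0# * ⟨ 0ᴹ , w ⟩   ≈⟨ zeroˡ _ ⟩
    0#                ∎
    where open SetoidReasoning setoid

  orthogonal-+ˡ : ∀ {u v} w → ⟨ u , w ⟩ ≈ 0# → ⟨ v , w ⟩ ≈ 0# → ⟨ u +ᴹ v , w ⟩ ≈ 0#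
  orthogonal-+ˡ {u} {v} w p q =
    trans (additive u v w) (trans (+-cong p q) (+-identityˡ 0#))

  orthogonal-*ₗˡ : ∀ t {v} w → ⟨ v , w ⟩ ≈ 0# → ⟨ t *ₗ v , w ⟩ ≈ 0#
  orthogonal-*ₗˡ t {v} w p = trans (scalar t v w) (trans (*-congˡ p) (zeroʳ t))

  -- The orthogonal complement of one vector, packaged as a subspace so that orthogonality passes
  -- from generators to linear combinations.
  kernel : Carrier → Subspace V
  kernel z = record
    { member = λ v → ⟨ v , z ⟩ ≈ 0#
    ; resp = λ v≈w p → trans (⟨,⟩-cong (≈ᴹ-sym v≈w) ≈ᴹ-refl) p
    ; 0-closed = orthogonal-zeroˡ z
    ; +-closed = orthogonal-+ˡ z
    ; *ₗ-closed = λ t → orthogonal-*ₗˡ t z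
    }

  _⟂_ : Carrier → Subspace V → Set ℓ
  z ⟂ T = ∀ w → Subspace.member T w → ⟨ z , w ⟩ ≈ 0#

  complement : Subspace V → Subspace V
  complement T = record
    { member = _⟂ T
    ; resp = λ v≈w p z Tz → Subspace.resp (kernel z) v≈w (p z Tz)
    ; 0-closed = λ z _ → orthogonal-zeroˡ z
    ; +-closed = λ p q z Tz → orthogonal-+ˡ z (p z Tz) (q z Tz)
    ; *ₗ-closed = λ t p z Tz → orthogonal-*ₗˡ t z (p z Tz)
    }

  _∩_ : Subspace V → Subspace V → Subspace V
  S ∩ T = record
    { member = λ v → S.member v × T.member v
    ; resp = λ v≈w (p , q) → S.resp v≈w p , T.resp v≈w q
    ; 0-closed = S.0-closed , T.0-closed
    ; +-closed = λ (p , q) (p' , q') → S.+-closed p p' , T.+-closed q q'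
    ; *ₗ-closed = λ t (p , q) → S.*ₗ-closed t p , T.*ₗ-closed t q
    }
    where
    module S = Subspace S
    module T = Subspace T

  -‿closed : ∀ (T : Subspace V) {v w} → Subspace.member T v → Subspace.member T w →
             Subspace.member T (v -ᴹ w)
  -‿closed T p q = Subspace.+-closed T p (neg-closed V T q)

  span-least : ∀ {S : Pred Carrier ℓ} (T : Subspace V) → (∀ {v} → S v → Subspace.member T v) →
               ∀ {v} → Span V S v → Subspace.member T v
  span-least T S⊆T (generator p)    = S⊆T p
  span-least T S⊆T (span-resp e p)  = Subspace.resp T e (span-least T S⊆T p)
  span-least T S⊆T span-zero        = Subspace.0-closed T
  span-least T S⊆T (span-add p q)   =
    Subspace.+-closed T (span-least T S⊆T p) (span-least T S⊆T q)
  span-least T S⊆T (span-scale t p) = Subspace.*ₗ-closed T t (span-least T S⊆T p)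

  pythagoras : ∀ {v w} → ⟨ v , w ⟩ ≈ 0# →
               ‖ v +ᴹ w ‖ * ‖ v +ᴹ w ‖ ≈ ‖ v ‖ * ‖ v ‖ + ‖ w ‖ * ‖ w ‖
  pythagoras {v} {w} v⟂w = begin
    ‖ v +ᴹ w ‖ * ‖ v +ᴹ w ‖              ≈⟨ norm-sq (v +ᴹ w) ⟩
    ⟨ v +ᴹ w , v +ᴹ w ⟩                  ≈⟨ additive v w (v +ᴹ w) ⟩
    ⟨ v , v +ᴹ w ⟩ + ⟨ w , v +ᴹ w ⟩      ≈⟨ +-cong (expand v) (expand w) ⟩
    (⟨ v , v ⟩ + ⟨ w , v ⟩) + (⟨ v , w ⟩ + ⟨ w , w ⟩)
      ≈⟨ +-cong (+-congˡ (trans (symmetric w v) v⟂w)) (+-congʳ v⟂w) ⟩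
    (⟨ v , v ⟩ + 0#) + (0# + ⟨ w , w ⟩)  ≈⟨ +-cong (+-identityʳ _) (+-identityˡ _) ⟩
    ⟨ v , v ⟩ + ⟨ w , w ⟩                ≈⟨ +-cong (norm-sq v) (norm-sq w) ⟨
    ‖ v ‖ * ‖ v ‖ + ‖ w ‖ * ‖ w ‖        ∎
    where
    open SetoidReasoning setoid
    expand : ∀ u → ⟨ u , v +ᴹ w ⟩ ≈ ⟨ v , u ⟩ + ⟨ w , u ⟩
    expand u = trans (symmetric u (v +ᴹ w)) (additive v w u)

  OrthogonalSplit : Subspace V → Carrier → Set ℓ
  OrthogonalSplit T v = ∃₂ λ t z → Subspace.member T t × z ⟂ T × v ≈ᴹ t +ᴹ z

  -- The coefficient is ⟨v,x⟩/⟨x,x⟩. If ⟨x,x⟩ vanishes, definiteness gives x = 0, both sides are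
  -- zero, and 0 is taken as a default.
  component-along : ∀ v x → ∃ λ β → ⟨ v , x ⟩ ≈ β * ⟨ x , x ⟩
  component-along v x with em {P = ⟨ x , x ⟩ ≈ 0#}
  ... | yes ⟨x,x⟩≈0 = 0# , (begin
    ⟨ v , x ⟩          ≈⟨ ⟨,⟩-cong ≈ᴹ-refl (‖‖-definite (x*x≈0⇒x≈0 (trans (norm-sq x) ⟨x,x⟩≈0))) ⟩
    ⟨ v , 0ᴹ ⟩         ≈⟨ symmetric v 0ᴹ ⟩
    ⟨ 0ᴹ , v ⟩         ≈⟨ orthogonal-zeroˡ v ⟩
    0#                 ≈⟨ zeroˡ _ ⟨
    0# * ⟨ x , x ⟩     ∎)
    where open SetoidReasoning setoid
  ... | no ⟨x,x⟩≉0 with s , xxs≈1 ← inverse ⟨ x , x ⟩ ⟨x,x⟩≉0 = ⟨ v , x ⟩ * s , (begin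
    ⟨ v , x ⟩                        ≈⟨ *-identityʳ _ ⟨
    ⟨ v , x ⟩ * 1#                   ≈⟨ *-congˡ (trans (*-comm s _) xxs≈1) ⟨
    ⟨ v , x ⟩ * (s * ⟨ x , x ⟩)      ≈⟨ *-assoc _ s _ ⟨
    (⟨ v , x ⟩ * s) * ⟨ x , x ⟩      ∎)
    where open SetoidReasoning setoid

  -- One Gram–Schmidt step: T is S together with one further direction x.
  split-extend :
    ∀ (S T : Subspace V) x → (∀ v → OrthogonalSplit S v) →
    (∀ {v} → Subspace.member S v → Subspace.member T v) → Subspace.member T x →
    (∀ {y} → Subspace.member T y → ∃₂ λ c s → Subspace.member S s × y ≈ᴹ c *ₗ x +ᴹ s) →
    ∀ v → OrthogonalSplit T v
  split-extend S T x split S⊆T Tx T⊆S+x v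
    with xs , x' , Sxs , x'⟂S , x≈ ← split x | vs , v' , Svs , v'⟂S , v≈ ← split v
    with β , β-eq ← component-along v' x' =
    vs +ᴹ β *ₗ x' , z , T.+-closed (S⊆T Svs) (T.*ₗ-closed β Tx') , z⟂T , v≈vs+βx'+z
    where
    module T = Subspace T
    -- With the component along x' removed, `z` is orthogonal to `S` and to x', hence to x = xs +
    -- x', and so to all of `T`.
    z = v' -ᴹ β *ₗ x'

    Tx' : T.member x'
    Tx' = T.resp (≈ᴹ-trans (+ᴹ-congʳ x≈) (G.xyx⁻¹≈y xs x')) (-‿closed T Tx (S⊆T Sxs))

    z⟂S : z ⟂ S
    z⟂S = -‿closed (complement S) v'⟂S (Subspace.*ₗ-closed (complement S) β x'⟂S)

    z⟂x' : ⟨ z , x' ⟩ ≈ 0#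
    z⟂x' = begin
      ⟨ v' -ᴹ β *ₗ x' , x' ⟩              ≈⟨ additive v' _ x' ⟩
      ⟨ v' , x' ⟩ + ⟨ -ᴹ (β *ₗ x') , x' ⟩ ≈⟨ +-cong β-eq neg ⟩
      β * ⟨ x' , x' ⟩ - β * ⟨ x' , x' ⟩   ≈⟨ -‿inverseʳ _ ⟩
      0#                                  ∎
      where
      open SetoidReasoning setoid
      neg : ⟨ -ᴹ (β *ₗ x') , x' ⟩ ≈ - (β * ⟨ x' , x' ⟩)
      neg = begin
        ⟨ -ᴹ (β *ₗ x') , x' ⟩        ≈⟨ ⟨,⟩-cong (-1*v≈-v V (β *ₗ x')) ≈ᴹ-refl ⟨
        ⟨ (- 1#) *ₗ (β *ₗ x') , x' ⟩ ≈⟨ scalar (- 1#) (β *ₗ x') x' ⟩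
        - 1# * ⟨ β *ₗ x' , x' ⟩      ≈⟨ RingProperties.-1*x≈-x ring _ ⟩
        - ⟨ β *ₗ x' , x' ⟩           ≈⟨ -‿cong (scalar β x' x') ⟩
        - (β * ⟨ x' , x' ⟩)          ∎

    module K = Subspace (kernel z)

    Kx : K.member x
    Kx = K.resp (≈ᴹ-sym x≈) (K.+-closed
      (trans (symmetric _ _) (z⟂S xs Sxs)) (trans (symmetric _ _) z⟂x'))

    z⟂T : z ⟂ T
    z⟂T y Ty with c , s , Ss , y≈ ← T⊆S+x Ty = trans (symmetric z y)
      (K.resp (≈ᴹ-sym y≈) (K.+-closed (K.*ₗ-closed c Kx) (trans (symmetric _ _) (z⟂S s Ss))))

    v≈vs+βx'+z : v ≈ᴹ (vs +ᴹ β *ₗ x') +ᴹ z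
    v≈vs+βx'+z = ≈ᴹ-trans v≈ (≈ᴹ-trans (+ᴹ-congˡ (≈ᴹ-trans
      (≈ᴹ-sym (G.//-rightDividesˡ (β *ₗ x') v')) (+ᴹ-comm _ _))) (≈ᴹ-sym (+ᴹ-assoc _ _ _)))

  Range : ∀ {d} → (Fin d → Carrier) → Pred Carrier ℓ
  Range b v = ∃ λ i → v ≈ᴹ b i

  -- The vectors of the asserted form make up a subspace containing every generator: the head with c
  -- = 1 and s = 0, the others with c = 0. So `span-least` applies.
  span-∷ : ∀ {d} (b : Fin (suc d) → Carrier) {v} → Span V (Range b) v →
           ∃₂ λ c s → Span V (Range (b ∘ suc)) s × v ≈ᴹ c *ₗ b zero +ᴹ s
  span-∷ b = span-least tail+line λ
    { (zero , v≈)  → 1# , 0ᴹ , span-zero ,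
        ≈ᴹ-trans v≈ (≈ᴹ-sym (≈ᴹ-trans (+ᴹ-identityʳ _) (*ₗ-identityˡ _)))
    ; (suc i , v≈) → 0# , b (suc i) , generator (i , ≈ᴹ-refl) ,
        ≈ᴹ-trans v≈ (≈ᴹ-sym (≈ᴹ-trans (+ᴹ-congʳ (*ₗ-zeroˡ _)) (+ᴹ-identityˡ _))) }
    where
    open CommutativeSemigroupProperties
      (AbelianGroup.commutativeSemigroup +ᴹ-abelianGroup) using (interchange)

    tail+line : Subspace V
    tail+line = record
      { member = λ v → ∃₂ λ c s → Span V (Range (b ∘ suc)) s × v ≈ᴹ c *ₗ b zero +ᴹ s
      ; resp = λ v≈w (c , s , p , v≈) → c , s , p , ≈ᴹ-trans (≈ᴹ-sym v≈w) v≈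
      ; 0-closed = 0# , 0ᴹ , span-zero ,
          ≈ᴹ-sym (≈ᴹ-trans (+ᴹ-congʳ (*ₗ-zeroˡ _)) (+ᴹ-identityˡ _))
      ; +-closed = λ (c , s , p , v≈) (c' , s' , p' , v'≈) → c + c' , s +ᴹ s' , span-add p p' ,
          ≈ᴹ-trans (+ᴹ-cong v≈ v'≈) (≈ᴹ-trans (interchange _ _ _ _)
            (+ᴹ-congʳ (≈ᴹ-sym (*ₗ-distribʳ _ c c'))))
      ; *ₗ-closed = λ t (c , s , p , v≈) → t * c , t *ₗ s , span-scale t p ,
          ≈ᴹ-trans (*ₗ-congˡ v≈) (≈ᴹ-trans (*ₗ-distribˡ t _ _)
            (+ᴹ-congʳ (≈ᴹ-sym (*ₗ-assoc t c _))))
      }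

  -- Induction on the number of spanning vectors, with no basis of `T` at hand. Either `T` already
  -- lies in the span of the tail, or some `x` in `T` does not. In the second case `T` is generated
  -- by `x` and its intersection with the tail span; the induction hypothesis splits along that
  -- intersection, and one Gram-Schmidt step adds `x`.
  split-below-span : ∀ {d} (b : Fin d → Carrier) (T : Subspace V) →
                     (∀ {v} → Subspace.member T v → Span V (Range b) v) →
                     ∀ v → OrthogonalSplit T v
  split-below-span {zero} b T T⊆span v =
    0ᴹ , v , Subspace.0-closed T , v⟂T , ≈ᴹ-sym (+ᴹ-identityˡ v)
    where
    v⟂T : v ⟂ T
    v⟂T w Tw = trans (symmetric v w) (span-least (kernel v) (λ ()) (T⊆span Tw))
  split-below-span {suc d} b T T⊆span
    with em {P = ∃ λ x → Subspace.member T x × ¬ Span V (Range (b ∘ suc)) x}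
  ... | no none = split-below-span (b ∘ suc) T T⊆tail
    where
    T⊆tail : ∀ {v} → Subspace.member T v → Span V (Range (b ∘ suc)) v
    T⊆tail {v} Tv with em {P = Span V (Range (b ∘ suc)) v}
    ... | yes p = p
    ... | no ¬p = contradiction (v , Tv , ¬p) none
  ... | yes (x , Tx , x∉tail) with c , x₁ , x₁∈tail , x≈ ← span-∷ b (T⊆span Tx) =
    split-extend (T ∩ tail) T x (split-below-span (b ∘ suc) (T ∩ tail) proj₂)
      proj₁ Tx T⊆T∩tail+x
    where
    module T = Subspace T
    tail = span V (Range (b ∘ suc))

    c≉0 : c ≉ 0#
    c≉0 c≈0 = x∉tail (span-resp (≈ᴹ-sym (≈ᴹ-trans x≈ (≈ᴹ-trans
      (+ᴹ-congʳ (≈ᴹ-trans (*ₗ-congʳ c≈0) (*ₗ-zeroˡ _))) (+ᴹ-identityˡ x₁)))) x₁∈tail)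

    T⊆T∩tail+x : ∀ {y} → T.member y →
                 ∃₂ λ g s → Subspace.member (T ∩ tail) s × y ≈ᴹ g *ₗ x +ᴹ s
    T⊆T∩tail+x {y} Ty
      with e , y₁ , y₁∈tail , y≈ ← span-∷ b (T⊆span Ty) | c⁻¹ , cc⁻¹≈1 ← inverse c c≉0 =
      g , y -ᴹ g *ₗ x ,
      ( -‿closed T Ty (T.*ₗ-closed g Tx)
      , span-resp (≈ᴹ-sym rest≈) (-‿closed tail y₁∈tail (span-scale g x₁∈tail))) ,
      ≈ᴹ-trans (≈ᴹ-sym (G.//-rightDividesˡ (g *ₗ x) y)) (+ᴹ-comm _ _)
      where
      -- Chosen so that the `b zero` coefficients of `y` and g x agree, which puts y - g x into the
      -- span of the tail.
      g = e * c⁻¹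

      gc≈e : g * c ≈ e
      gc≈e = begin
        (e * c⁻¹) * c ≈⟨ *-assoc e c⁻¹ c ⟩
        e * (c⁻¹ * c) ≈⟨ *-congˡ (trans (*-comm c⁻¹ c) cc⁻¹≈1) ⟩
        e * 1#        ≈⟨ *-identityʳ e ⟩
        e             ∎
        where open SetoidReasoning setoid

      rest≈ : y -ᴹ g *ₗ x ≈ᴹ y₁ -ᴹ g *ₗ x₁
      rest≈ = begin
        y -ᴹ g *ₗ x
          ≈⟨ +ᴹ-cong y≈ (-ᴹ‿cong (≈ᴹ-trans (*ₗ-congˡ x≈) (*ₗ-distribˡ g _ _))) ⟩
        (e *ₗ b zero +ᴹ y₁) -ᴹ (g *ₗ (c *ₗ b zero) +ᴹ g *ₗ x₁)
          ≈⟨ G.∙-//-distrib _ _ _ _ ⟩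
        (e *ₗ b zero -ᴹ g *ₗ (c *ₗ b zero)) +ᴹ (y₁ -ᴹ g *ₗ x₁)
          ≈⟨ +ᴹ-congʳ (G.x≈y⇒x∙y⁻¹≈ε (≈ᴹ-trans (*ₗ-congʳ (sym gc≈e)) (*ₗ-assoc g c _))) ⟩
        0ᴹ +ᴹ (y₁ -ᴹ g *ₗ x₁)
          ≈⟨ +ᴹ-identityˡ _ ⟩
        y₁ -ᴹ g *ₗ x₁ ∎
        where open SetoidReasoning ≈ᴹ-setoid

  linearCombination∈span : ∀ {d} (c : Fin d → ℝ) (b : Fin d → Carrier) (T : Subspace V) →
                           (∀ i → Subspace.member T (b i)) →
                           Subspace.member T (linearCombination V c b)
  linearCombination∈span {zero} c b T Tb = Subspace.0-closed T
  linearCombination∈span {suc d} c b T Tb = Subspace.+-closed T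
    (Subspace.*ₗ-closed T (c zero) (Tb zero))
    (linearCombination∈span (c ∘ suc) (b ∘ suc) T (Tb ∘ suc))

  -- A finite family spanning the whole space spans every `T` from above, so `split-below-span`
  -- applies to each.
  orthogonal-split : ∀ {d} → HasDimension V d → ∀ T v → OrthogonalSplit T v
  orthogonal-split (b , _ , spanning) T = split-below-span b T λ {v} _ →
    let c , v≈ = spanning v
    in span-resp (≈ᴹ-sym v≈) (linearCombination∈span c b (span V (Range b))
         λ i → generator (i , ≈ᴹ-refl))

-- Best-return denominators and the clusters that they form.

module Returns {ℓ} (em : ExcludedMiddle ℓ) {R : Reals ℓ} (V : NormedSpace R)
  (U : UltrametricGroup R) (Λ : Subgroup (productGroup V U))
  (α : AbelianGroup.Carrier (X V U Λ)) where

  open Reals R hiding (zero)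
  open RealOrder em R
  private
    module V = NormedSpace V
    module VG = GroupProperties V.+ᴹ-abelianGroup
    module U = UltrametricGroup U
    module UG = GroupProperties U.abelianGroup
    module UM = IsGeneralMetric U.isUltrametric
    module Λ = Subgroup Λ
    module X where
      open AbelianGroup (X V U Λ) public
      open GroupProperties (X V U Λ) public
    module P where
      open AbelianGroup (productGroup V U) public
      open GroupProperties (productGroup V U) public
    module X× = Mult X.monoid

    Denominator : ℕ → ℕ → Set ℓ
    Denominator = IsDenominator V U Λ α

    return : ℕ → ℝ
    return = ρ V U Λ α

  denominator-unique : ∀ {n q q'} → Denominator n q → Denominator n q' → q ≡ q'
  denominator-unique first first = ≡.refl
  denominator-unique (next D q<r ρr least) (next D' q<r' ρr' least')
    with ≡.refl ← denominator-unique D D' =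
    ℕ.≤-antisym (least _ q<r' ρr') (least' _ q<r ρr)

  -- The derivation of a term contains all earlier terms. Numbering starts at 1, hence the term
  -- `suc m` for m < n.
  denominator-earlier : ∀ {n q} m → Denominator n q → m ℕ.< n → ∃ (Denominator (suc m))
  denominator-earlier zero first _ = 1 , first
  denominator-earlier (suc m) first (ℕ.s≤s ())
  denominator-earlier m D@(next D' _ _ _) m<n with ℕ.m<1+n⇒m<n∨m≡n m<n
  ... | inj₁ m<n'   = denominator-earlier m D' m<n'
  ... | inj₂ ≡.refl = _ , D

  denominator-mono-< : ∀ {m n q r} → m ℕ.< n → Denominator m q → Denominator n r →
                       q ℕ.< r × return r < return q
  denominator-mono-< (ℕ.s≤s ℕ.z≤n) () first
  denominator-mono-< m<n D (next D' q<r ρr<ρq _) with ℕ.m<1+n⇒m<n∨m≡n m<n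
  ... | inj₁ m<n' =
    let p<q , ρq<ρp = denominator-mono-< m<n' D D'
    in ℕ.<-trans p<q q<r , <-≤-trans ρr<ρq (proj₁ ρq<ρp)
  ... | inj₂ ≡.refl with ≡.refl ← denominator-unique D D' = q<r , ρr<ρq

  denominator-mono-≤ : ∀ {m n q r} → m ℕ.≤ n → Denominator m q → Denominator n r → q ℕ.≤ r
  denominator-mono-≤ m≤n D D' with ℕ.m≤n⇒m<n∨m≡n m≤n
  ... | inj₁ m<n    = ℕ.<⇒≤ (proj₁ (denominator-mono-< m<n D D'))
  ... | inj₂ ≡.refl = ℕ.≤-reflexive (denominator-unique D D')

  -- Induction along the sequence: multiples up to the previous term are covered by the induction
  -- hypothesis, and those strictly between two consecutive terms cannot improve on the previous
  -- one, by leastness of the new term.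
  denominator-best : ∀ {n q} → Denominator n q → ∀ δ → 0 ℕ.< δ → δ ℕ.≤ q →
                     return q ≤ return δ
  denominator-best first (suc zero) _ _ = ≤-refl
  denominator-best first (suc (suc _)) _ (ℕ.s≤s ())
  denominator-best (next {q = q} D q<q' ρq'<ρq least) δ 0<δ δ≤q'
    with ℕ.m≤n⇒m<n∨m≡n δ≤q' | δ ℕ.≤? q
  ... | inj₂ ≡.refl | _       = ≤-refl
  ... | inj₁ _      | yes δ≤q = ≤-trans (proj₁ ρq'<ρq) (denominator-best D δ 0<δ δ≤q)
  ... | inj₁ δ<q'   | no δ≰q  = ≤-trans (proj₁ ρq'<ρq)
    (≮⇒≥ λ ρδ<ρq → ℕ.<⇒≱ δ<q' (least δ (ℕ.≰⇒> δ≰q) ρδ<ρq))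

  -- The interface between the arithmetic of the sequence and the packing arguments. A difference of
  -- times is stored as a `δ` with a sum equation rather than as truncated subtraction. `large` lets
  -- the Euclidean argument compare drifts.
  record ClusteredReturns (Q k : ℕ) : Set ℓ where
    field
      time  : Fin k → ℕ
      large : ∀ i → Q ℕ.≤ time i
      close : ∀ i → return (time i) < return Q
      gap   : ∀ i j → i Fin.< j →
              ∃ λ δ → δ ℕ.+ time i ≡ time j × δ ℕ.≤ Q × return Q ≤ return δ

  -- The p + 1 consecutive terms from `q'` to `r` lie in an interval of length at most `q`, so every
  -- difference is positive and at most `q`, and `denominator-best` bounds its return from below.
  clustered : ∀ {n p q q' r} → Denominator n q → Denominator (suc n) q' →
              Denominator (suc n ℕ.+ p) r → r ℕ.≤ q ℕ.+ q' → ClusteredReturns q (suc p)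
  clustered {n} {p} {q} {q'} {r} D D' D'' r≤q+q' = record
    { time = time
    ; large = λ i → ℕ.<⇒≤ (proj₁ (after i))
    ; close = λ i → proj₂ (after i)
    ; gap = λ i j i<j →
        let ti<tj = proj₁ (denominator-mono-< (ℕ.s≤s (ℕ.+-monoʳ-< n i<j)) (term i) (term j))
            δ≤q   = ℕ.m≤n+o⇒m∸n≤o (time j) (time i) (ℕ.≤-trans (time≤r j)
                      (ℕ.≤-trans r≤q+q' (ℕ.≤-trans (ℕ.+-monoʳ-≤ q (q'≤time i))
                        (ℕ.≤-reflexive (ℕ.+-comm q (time i))))))
        in time j ℕ.∸ time i , ℕ.m∸n+n≡m (ℕ.<⇒≤ ti<tj) , δ≤q ,
           denominator-best D _ (ℕ.m<n⇒0<n∸m ti<tj) δ≤q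
    }
    where
    index≤ : ∀ (i : Fin (suc p)) → n ℕ.+ toℕ i ℕ.≤ n ℕ.+ p
    index≤ i = ℕ.+-monoʳ-≤ n (Fin.toℕ≤pred[n] i)

    time : Fin (suc p) → ℕ
    time i = proj₁ (denominator-earlier (n ℕ.+ toℕ i) D'' (ℕ.s≤s (index≤ i)))

    term : ∀ i → Denominator (suc (n ℕ.+ toℕ i)) (time i)
    term i = proj₂ (denominator-earlier (n ℕ.+ toℕ i) D'' (ℕ.s≤s (index≤ i)))

    after : ∀ i → q ℕ.< time i × return (time i) < return q
    after i = denominator-mono-< (ℕ.s≤s (ℕ.m≤m+n n _)) D (term i)

    q'≤time : ∀ i → q' ℕ.≤ time i
    q'≤time i = denominator-mono-≤ (ℕ.s≤s (ℕ.m≤m+n n _)) D' (term i)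

    time≤r : ∀ i → time i ℕ.≤ r
    time≤r i = denominator-mono-≤ (ℕ.s≤s (index≤ i)) (term i) D''

  -- Lifts of multiples of `α` to the product group.

  infix 4 _represents_
  _represents_ : P.Carrier → ℕ → Set ℓ
  a represents m = a X.≈ m X×.× α

  maxNorm-cong : ∀ {a b} → a P.≈ b → maxNorm V U a ≈ maxNorm V U b
  maxNorm-cong (v≈ , u≈) = ⊔-cong (V.‖‖-cong v≈) (UM.cong u≈ U.refl)

  ∣-∣ᵁ≤⊔ : ∀ u w → U.∣ u U.- w ∣ᵁ ≤ U.∣ u ∣ᵁ ⊔ U.∣ w ∣ᵁ
  ∣-∣ᵁ≤⊔ u w = begin
    U.∣ u U.- w ∣ᵁ                          ≈⟨ U.translationInvariant ⟨
    U.dist ((u U.- w) U.∙ w) (U.ε U.∙ w)    ≈⟨ UM.cong (UG.//-rightDividesˡ w u) (U.identityˡ w) ⟩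
    U.dist u w                              ≤⟨ UM.triangle u U.ε w ⟩
    U.∣ u ∣ᵁ ⊔ U.dist U.ε w                 ≈⟨ ⊔-cong refl (UM.sym U.ε w) ⟩
    U.∣ u ∣ᵁ ⊔ U.∣ w ∣ᵁ                     ∎
    where open PosetReasoning poset

  private
    open module QN = QuotientNorm R (productGroup V U)

  -- The lift `a` occurs among the competitors of the infimum, for the element x - a of `Λ`.
  return≤maxNorm : ∀ {a} δ → a represents δ → return δ ≤ maxNorm V U a
  return≤maxNorm {a} δ a∼ = begin
    return δ                        ≤⟨ quotientNorm-≤ (maxNorm V U) (maxNorm-nonneg V U) Λ x x-a∈Λ ⟩
    maxNorm V U (x P.- (x P.- a))   ≈⟨ maxNorm-cong (P.trans (P.∙-congˡ (P.⁻¹-anti-homo-// x a)) cancel) ⟩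
    maxNorm V U a                   ∎
    where
    open PosetReasoning poset
    x : P.Carrier
    x = (δ X×.× α) X.- X.ε
    x-a∈Λ : Λ.member (x P.- a)
    x-a∈Λ = X.trans (X.x//ε≈x (δ X×.× α)) (X.sym a∼)
    cancel : x P.∙ (a P.- x) P.≈ a
    cancel = P.trans (P.comm x (a P.- x)) (P.//-rightDividesˡ x a)

  -- The infimum may not be attained, but strictness leaves room: were no lift shorter than `r`,
  -- then `r` would be a lower bound and could not exceed the infimum.
  short-representative : ∀ m {r} → return m < r →
                         ∃ λ a → a represents m × maxNorm V U a < r
  short-representative m {r} ρm<r = let h , Λh , short = near in
    x P.- h , represents-m Λh , short
    where
    x : P.Carrier
    x = (m X×.× α) X.- X.ε

    near : ∃ λ h → Λ.member h × maxNorm V U (x P.- h) < r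
    near with em {P = ∃ λ h → Λ.member h × maxNorm V U (x P.- h) < r}
    ... | yes found = found
    ... | no none   = contradiction
      (quotientNorm-greatest (maxNorm V U) (maxNorm-nonneg V U) Λ x r
        λ h Λh → ≮⇒≥ λ short → none (h , Λh , short))
      (<⇒≱ ρm<r)

    represents-m : ∀ {h} → Λ.member h → x P.- h represents m
    represents-m {h} Λh = begin
      x X.- h     ≈⟨ X.//-cong₂ {x} {x} {h} {X.ε} (X.refl {x}) (Λ.resp (P.sym (P.x//ε≈x h)) Λh) ⟩
      x X.- X.ε   ≈⟨ X.x//ε≈x x ⟩
      x           ≈⟨ X.x//ε≈x (m X×.× α) ⟩
      m X×.× α    ∎
      where open SetoidReasoning X.setoid

  module Representatives {Q k} (C : ClusteredReturns Q k) where
    open ClusteredReturns C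

    rep : Fin k → P.Carrier
    rep i = proj₁ (short-representative (time i) (close i))

    rep-represents : ∀ i → rep i represents time i
    rep-represents i = proj₁ (proj₂ (short-representative (time i) (close i)))

    rep-short : ∀ i → maxNorm V U (rep i) < return Q
    rep-short i = proj₂ (proj₂ (short-representative (time i) (close i)))

    real : Fin k → V.Carrier
    real = proj₁ ∘ rep

    real-short : ∀ i → V.‖ real i ‖ < return Q
    real-short i = ≤-<-trans (x≤x⊔y _ _) (rep-short i)

    -- Since (w , 0) lies in `Λ`, subtracting it leaves a lift of δ α, of norm at least `return Q`.
    -- Its ultrametric coordinate stays below that value, so the real coordinate must reach it.
    real-apart : ∀ i j → i Fin.< j → ∀ w → Subspace.member (W V U Λ) w →
                 return Q ≤ V.‖ (real j V.-ᴹ real i) V.-ᴹ w ‖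
    real-apart i j i<j w Ww with δ , δ+ti≡tj , _ , ρQ≤ρδ ← gap i j i<j =
      ≤-⊔-resolveʳ (≤-trans ρQ≤ρδ (return≤maxNorm δ diff∼)) ultra-short
      where
      diff : P.Carrier
      diff = (rep j P.- rep i) P.- (w , U.ε)

      w≈ε : (w , U.ε) X.≈ X.ε
      w≈ε = Λ.resp (P.sym (P.trans (P.x//ε≈x _) (V.≈ᴹ-sym (V.*ₗ-identityˡ w) , U.refl)))
        (Ww 1#)

      diff∼ : diff represents δ
      diff∼ = begin
        (rep j P.- rep i) P.- (w , U.ε)
          ≈⟨ X.∙-cong (X.∙-cong (rep-represents j) (X.⁻¹-cong (rep-represents i)))
                      (X.trans (X.⁻¹-cong w≈ε) X.ε⁻¹≈ε) ⟩
        ((time j X×.× α) X.- (time i X×.× α)) X.∙ X.ε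
          ≈⟨ X.identityʳ _ ⟩
        (time j X×.× α) X.- (time i X×.× α)
          ≈⟨ X.∙-congʳ (X×.×-congˡ (≡.sym δ+ti≡tj)) ⟩
        ((δ ℕ.+ time i) X×.× α) X.- (time i X×.× α)
          ≈⟨ X.∙-congʳ (X×.×-homo-+ α δ (time i)) ⟩
        ((δ X×.× α) X.∙ (time i X×.× α)) X.- (time i X×.× α)
          ≈⟨ X.//-rightDividesʳ (time i X×.× α) (δ X×.× α) ⟩
        δ X×.× α ∎
        where open SetoidReasoning X.setoid

      ultra-short : U.∣ proj₂ diff ∣ᵁ < return Q
      ultra-short = ≤-<-trans (≤-reflexive (UM.cong (UG.x//ε≈x _) U.refl))
        (≤-<-trans (∣-∣ᵁ≤⊔ (proj₂ (rep j)) (proj₂ (rep i)))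
          (⊔-lub-< (≤-<-trans (x≤y⊔x _ _) (rep-short j))
                   (≤-<-trans (x≤y⊔x _ _) (rep-short i))))

  -- The bound for an arbitrary norm, by packing in V / W.

  module _ (closed : IsClosed V U Λ) where

    private
      V̄ : NormedSpace R
      V̄ = reducedRealFactor V U Λ em closed

      module V̄ = NormedSpace V̄

      module QV = QuotientNorm R V.+ᴹ-abelianGroup

      W≤ : Subgroup V.+ᴹ-abelianGroup
      W≤ = subgroup V (W V U Λ)

    -- `real-apart` holds for every `w` in W, so `return Q` bounds the quotient norms of differences
    -- from below, while the choice w = 0 keeps the points themselves below it.
    reduced-packing-bound : ∀ {Q k p} → ClusteredReturns Q (suc k) →
                            IsPackingNumber V̄ p → suc k ℕ.≤ p
    reduced-packing-bound {Q} C maximal = spread⇒≤packingNumber maximal real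
      short λ h i j i<j → <-≤-trans (short h)
        (QV.quotientNorm-greatest V.‖_‖ V.‖‖-nonneg W≤ _ _ (real-apart i j i<j))
      where
      open Representatives C
      open Packing em R V̄

      short : ∀ i → V̄.‖ real i ‖ < return Q
      short i = ≤-<-trans
        (≤-trans (QV.quotientNorm-≤ V.‖_‖ V.‖‖-nonneg W≤ (real i) (Subgroup.ε-closed W≤))
          (≤-reflexive (V.‖‖-cong (VG.x//ε≈x (real i)))))
        (real-short i)

  -- The Euclidean bound, by packing in the effective real factor.

  module _ (ip : InnerProduct V)
    (split : ∀ T v → OrthogonalProjection.OrthogonalSplit em V ip T v) where

    open InnerProduct ip
    open OrthogonalProjection em V ip
    open RealProperties R

    private
      Projected : Pred V.Carrier ℓ
      Projected z = ∃ λ v → ∃ λ u → Λ.member (v , u) × IsProjection V U Λ ip v z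

      Wₛ E : Subspace V
      Wₛ = W V U Λ
      E = span V Projected

      module Wₛ = Subspace Wₛ
      module E = Subspace E
      module W⊥ = Subspace (complement Wₛ)

      base : V.Carrier
      base = proj₁ α

    real-multiple : ∀ m → proj₁ (m X×.× α) V.≈ᴹ fromℕ m V.*ₗ base
    real-multiple zero    = V.≈ᴹ-sym (V.*ₗ-zeroˡ base)
    real-multiple (suc m) = begin
      base V.+ᴹ proj₁ (m X×.× α)              ≈⟨ V.+ᴹ-cong (V.≈ᴹ-sym (V.*ₗ-identityˡ base)) (real-multiple m) ⟩
      1# V.*ₗ base V.+ᴹ fromℕ m V.*ₗ base     ≈⟨ V.*ₗ-distribʳ base 1# (fromℕ m) ⟨
      (1# + fromℕ m) V.*ₗ base                ∎
      where open SetoidReasoning V.≈ᴹ-setoid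

    E⊆W⊥ : ∀ {e} → E.member e → e ⟂ Wₛ
    E⊆W⊥ = span-least (complement Wₛ) λ (_ , _ , _ , z⟂W , _) → z⟂W

    -- The component of a lattice vector orthogonal to W is by definition a generator of `E`, so
    -- nothing remains outside W + E.
    lattice-split : ∀ {v u} → Λ.member (v , u) →
                    ∃₂ λ w e → Wₛ.member w × E.member e × v V.≈ᴹ w V.+ᴹ e
    lattice-split {v} {u} Λvu with w , z , Ww , z⟂W , v≈ ← split Wₛ v =
      w , z , Ww , generator (v , u , Λvu , z⟂W , Wₛ.resp w≈v-z Ww) , v≈
      where
      w≈v-z : w V.≈ᴹ v V.-ᴹ z
      w≈v-z = V.≈ᴹ-trans (V.≈ᴹ-sym (VG.//-rightDividesʳ z w)) (V.+ᴹ-congʳ (V.≈ᴹ-sym v≈))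

    -- One decomposition of the real coordinate of `α`, fixed once so that all lifts share the same
    -- `drift`.
    record BaseSplit : Set ℓ where
      field
        w₀ e₀ drift : V.Carrier
        W-w₀        : Wₛ.member w₀
        E-e₀        : E.member e₀
        drift⟂W     : drift ⟂ Wₛ
        drift⟂E     : drift ⟂ E
        base≈       : base V.≈ᴹ (w₀ V.+ᴹ e₀) V.+ᴹ drift

    base-split : BaseSplit
    base-split with w₀ , z , W-w₀ , z⟂W , base≈ ← split Wₛ base
               with e₀ , f , E-e₀ , f⟂E , z≈ ← split E z = record
      { w₀ = w₀ ; e₀ = e₀ ; drift = f ; W-w₀ = W-w₀ ; E-e₀ = E-e₀
      -- The drift equals z - e₀, a difference of two vectors orthogonal to W.
      ; drift⟂W = W⊥.resp (V.≈ᴹ-trans (V.+ᴹ-congʳ z≈) (VG.xyx⁻¹≈y e₀ f))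
          (-‿closed (complement Wₛ) z⟂W (E⊆W⊥ E-e₀))
      ; drift⟂E = f⟂E
      ; base≈ = V.≈ᴹ-trans base≈ (V.≈ᴹ-trans (V.+ᴹ-congˡ z≈) (V.≈ᴹ-sym (V.+ᴹ-assoc w₀ e₀ f)))
      }

    open BaseSplit base-split

    -- A lift differs from m α by an element of `Λ`, which changes only the W and `E` components;
    -- the coefficient of `drift` is therefore exactly m.
    representative-split :
      ∀ {a} m → a represents m → ∃₂ λ w e → Wₛ.member w × E.member e ×
      proj₁ a V.≈ᴹ w V.+ᴹ (e V.+ᴹ fromℕ m V.*ₗ drift)
    representative-split {v , u} m a∼ with w , e , Ww , Ee , l≈ ← lattice-split a∼ =
      w V.+ᴹ t V.*ₗ w₀ , e V.+ᴹ t V.*ₗ e₀ ,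
      Wₛ.+-closed Ww (Wₛ.*ₗ-closed t W-w₀) , E.+-closed Ee (E.*ₗ-closed t E-e₀) , (begin
        v
          ≈⟨ VG.//-rightDividesˡ mv v ⟨
        (v V.-ᴹ mv) V.+ᴹ mv
          ≈⟨ V.+ᴹ-cong l≈ (V.≈ᴹ-trans (real-multiple m) (V.*ₗ-congˡ base≈)) ⟩
        (w V.+ᴹ e) V.+ᴹ t V.*ₗ ((w₀ V.+ᴹ e₀) V.+ᴹ drift)
          ≈⟨ V.+ᴹ-congˡ (V.≈ᴹ-trans (V.*ₗ-distribˡ t _ _) (V.+ᴹ-congʳ (V.*ₗ-distribˡ t _ _))) ⟩
        (w V.+ᴹ e) V.+ᴹ ((t V.*ₗ w₀ V.+ᴹ t V.*ₗ e₀) V.+ᴹ t V.*ₗ drift)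
          ≈⟨ V.+ᴹ-assoc _ _ _ ⟨
        ((w V.+ᴹ e) V.+ᴹ (t V.*ₗ w₀ V.+ᴹ t V.*ₗ e₀)) V.+ᴹ t V.*ₗ drift
          ≈⟨ V.+ᴹ-congʳ (interchange _ _ _ _) ⟩
        ((w V.+ᴹ t V.*ₗ w₀) V.+ᴹ (e V.+ᴹ t V.*ₗ e₀)) V.+ᴹ t V.*ₗ drift
          ≈⟨ V.+ᴹ-assoc _ _ _ ⟩
        (w V.+ᴹ t V.*ₗ w₀) V.+ᴹ ((e V.+ᴹ t V.*ₗ e₀) V.+ᴹ t V.*ₗ drift) ∎)
      where
      t = fromℕ m
      mv = proj₁ (m X×.× α)
      open SetoidReasoning V.≈ᴹ-setoid
      open CommutativeSemigroupProperties
        (AbelianGroup.commutativeSemigroup V.+ᴹ-abelianGroup) using (interchange)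

    ‖_‖² : V.Carrier → ℝ
    ‖ v ‖² = V.‖ v ‖ * V.‖ v ‖

    ‖e+drift‖² : ∀ {e} t → E.member e →
                 ‖ e V.+ᴹ t V.*ₗ drift ‖² ≈ ‖ e ‖² + ‖ t V.*ₗ drift ‖²
    ‖e+drift‖² {e} t Ee = pythagoras
      (trans (symmetric e _) (orthogonal-*ₗˡ t e (drift⟂E e Ee)))

    drift-mono : ∀ {m n} → m ℕ.≤ n → ‖ fromℕ m V.*ₗ drift ‖² ≤ ‖ fromℕ n V.*ₗ drift ‖²
    drift-mono {m} {n} m≤n = square-mono-≤ (V.‖‖-nonneg _) (begin
      V.‖ fromℕ m V.*ₗ drift ‖     ≈⟨ ‖multiple‖ m ⟩
      fromℕ m * V.‖ drift ‖        ≤⟨ *-mono-≤ (fromℕ-nonneg m) (V.‖‖-nonneg drift) (fromℕ-mono-≤ m≤n) ≤-refl ⟩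
      fromℕ n * V.‖ drift ‖        ≈⟨ ‖multiple‖ n ⟨
      V.‖ fromℕ n V.*ₗ drift ‖     ∎)
      where
      open PosetReasoning poset
      ‖multiple‖ : ∀ k → V.‖ fromℕ k V.*ₗ drift ‖ ≈ fromℕ k * V.‖ drift ‖
      ‖multiple‖ k = trans (V.‖‖-homogeneous (fromℕ k) drift)
        (*-congʳ (0≤x⇒∣x∣≈x (fromℕ-nonneg k)))

    effective-packing-bound : ∀ {Q k p} → ClusteredReturns Q (suc k) →
                              IsPackingNumber (effectiveRealFactor V U Λ ip) p → suc k ℕ.≤ p
    effective-packing-bound {Q} {k} C maximal =
      spread⇒≤packingNumber maximal (λ i → e i , E-e i) e-short e-apart
      where
      open ClusteredReturns C
      open Representatives C
      open Packing em R (effectiveRealFactor V U Λ ip)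

      splitting : ∀ i → ∃₂ λ w e → Wₛ.member w × E.member e ×
                  real i V.≈ᴹ w V.+ᴹ (e V.+ᴹ fromℕ (time i) V.*ₗ drift)
      splitting i = representative-split (time i) (rep-represents i)

      w e f : Fin (suc k) → V.Carrier
      w i = proj₁ (splitting i)
      e i = proj₁ (proj₂ (splitting i))
      f i = fromℕ (time i) V.*ₗ drift

      W-w : ∀ i → Wₛ.member (w i)
      W-w i = proj₁ (proj₂ (proj₂ (splitting i)))

      E-e : ∀ i → E.member (e i)
      E-e i = proj₁ (proj₂ (proj₂ (proj₂ (splitting i))))

      real≈ : ∀ i → real i V.≈ᴹ w i V.+ᴹ (e i V.+ᴹ f i)
      real≈ i = proj₂ (proj₂ (proj₂ (proj₂ (splitting i))))

      0≤‖‖² : ∀ v → 0# ≤ ‖ v ‖²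
      0≤‖‖² v = *-nonneg (V.‖‖-nonneg v) (V.‖‖-nonneg v)

      ‖e‖²+‖f‖²<r² : ∀ i → ‖ e i ‖² + ‖ f i ‖² < return Q * return Q
      ‖e‖²+‖f‖²<r² i = begin-strict
        ‖ e i ‖² + ‖ f i ‖²                 ≈⟨ ‖e+drift‖² (fromℕ (time i)) (E-e i) ⟨
        ‖ e i V.+ᴹ f i ‖²                   ≈⟨ +-identityˡ _ ⟨
        0# + ‖ e i V.+ᴹ f i ‖²              ≤⟨ +-mono-≤ (0≤‖‖² (w i)) ≤-refl ⟩
        ‖ w i ‖² + ‖ e i V.+ᴹ f i ‖²        ≈⟨ pythagoras w⟂e+f ⟨
        ‖ w i V.+ᴹ (e i V.+ᴹ f i) ‖²        ≈⟨ *-cong (V.‖‖-cong (real≈ i)) (V.‖‖-cong (real≈ i)) ⟨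
        ‖ real i ‖²                         <⟨ square-mono-< (V.‖‖-nonneg _) (real-short i) ⟩
        return Q * return Q                 ∎
        where
        open PosetReasoning poset
        w⟂e+f : ⟨ w i , e i V.+ᴹ f i ⟩ ≈ 0#
        w⟂e+f = trans (symmetric _ _)
          (W⊥.+-closed (E⊆W⊥ (E-e i)) (W⊥.*ₗ-closed (fromℕ (time i)) drift⟂W) (w i) (W-w i))

      0≤return : 0# ≤ return Q
      0≤return = ≤-trans (V.‖‖-nonneg (real zero)) (proj₁ (real-short zero))

      e-short : ∀ i → V.‖ e i ‖ < return Q
      e-short i = square-cancel-< 0≤return (begin-strict
        ‖ e i ‖²               ≈⟨ +-identityʳ _ ⟨
        ‖ e i ‖² + 0#          ≤⟨ +-monoʳ-≤ _ (0≤‖‖² (f i)) ⟩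
        ‖ e i ‖² + ‖ f i ‖²    <⟨ ‖e‖²+‖f‖²<r² i ⟩
        return Q * return Q    ∎)
        where open PosetReasoning poset

      e-apart : ∀ h i j → i Fin.< j → V.‖ e h ‖ < V.‖ e j V.-ᴹ e i ‖
      e-apart h i j i<j with δ , δ+ti≡tj , δ≤Q , _ ← gap i j i<j =
        square-cancel-< (V.‖‖-nonneg _) (x+y<z+w∧w≤y⇒x<z (begin-strict
          ‖ e h ‖² + ‖ f h ‖²
            <⟨ ‖e‖²+‖f‖²<r² h ⟩
          return Q * return Q
            -- `real-apart` is used with w = w_j - w_i, which cancels the W components of the two
            -- lifts.
            ≤⟨ square-mono-≤ 0≤return (real-apart i j i<j _ (-‿closed Wₛ (W-w j) (W-w i))) ⟩
          ‖ (real j V.-ᴹ real i) V.-ᴹ (w j V.-ᴹ w i) ‖²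
            ≈⟨ *-cong (V.‖‖-cong difference) (V.‖‖-cong difference) ⟩
          ‖ (e j V.-ᴹ e i) V.+ᴹ fromℕ δ V.*ₗ drift ‖²
            ≈⟨ ‖e+drift‖² (fromℕ δ) (-‿closed E (E-e j) (E-e i)) ⟩
          ‖ e j V.-ᴹ e i ‖² + ‖ fromℕ δ V.*ₗ drift ‖² ∎)
          (drift-mono (ℕ.≤-trans δ≤Q (large h))))
        where
        open PosetReasoning poset

        f-difference : f j V.-ᴹ f i V.≈ᴹ fromℕ δ V.*ₗ drift
        f-difference = V.≈ᴹ-trans (V.+ᴹ-congʳ (V.≈ᴹ-trans
          (V.*ₗ-congʳ (trans (reflexive (≡.cong fromℕ (≡.sym δ+ti≡tj))) (fromℕ-homo-+ δ (time i))))
          (V.*ₗ-distribʳ drift _ _))) (VG.//-rightDividesʳ (f i) _)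

        difference : (real j V.-ᴹ real i) V.-ᴹ (w j V.-ᴹ w i)
                     V.≈ᴹ (e j V.-ᴹ e i) V.+ᴹ fromℕ δ V.*ₗ drift
        difference = V.≈ᴹ-trans (V.+ᴹ-congʳ (V.≈ᴹ-trans
          (V.+ᴹ-cong (real≈ j) (V.-ᴹ‿cong (real≈ i))) (VG.∙-//-distrib _ _ _ _)))
          (V.≈ᴹ-trans (VG.xyx⁻¹≈y _ _)
            (V.≈ᴹ-trans (VG.∙-//-distrib _ _ _ _) (V.+ᴹ-congˡ f-difference)))

-- Both inequalities, by contradiction from a packing with one point too many.

open import Data.Nat.Base using (_+_; _≤_; _<_)

proposition2 : ∀ {ℓ} (em : ExcludedMiddle ℓ) (R : Reals ℓ)
    (V : NormedSpace R) (d : ℕ) → 1 ≤ d → HasDimension V d →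
    (U : UltrametricGroup R)
    (Λ : Subgroup (productGroup V U)) (closed : IsClosed V U Λ)
    (α : AbelianGroup.Carrier (X V U Λ)) →
    ((p : ℕ) → IsPackingNumber (reducedRealFactor V U Λ em closed) p →
    ∀ n qₙ qₙ₊₁ q → 1 ≤ n →
    IsDenominator V U Λ α n qₙ →
    IsDenominator V U Λ α (n + 1) qₙ₊₁ →
    IsDenominator V U Λ α (n + p + 1) q →
    qₙ + qₙ₊₁ < q)
    ×
    ((ip : InnerProduct V) →
    (p : ℕ) → IsPackingNumber (effectiveRealFactor V U Λ ip) p →
    ∀ n qₙ qₙ₊₁ q → 1 ≤ n →
    IsDenominator V U Λ α n qₙ →
    IsDenominator V U Λ α (n + 1) qₙ₊₁ →
    IsDenominator V U Λ α (n + p + 1) q →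
    qₙ + qₙ₊₁ < q)
proposition2 {ℓ} em R V d _ dim U Λ closed α =
  (λ p maximal n qₙ qₙ₊₁ q _ → bound n p λ C → reduced-packing-bound closed C maximal) ,
  (λ ip p maximal n qₙ qₙ₊₁ q _ → bound n p λ C →
    effective-packing-bound ip
      (OrthogonalProjection.orthogonal-split em V ip dim) C maximal)
  where
  open Returns em V U Λ α

  bound : ∀ n p {q q' r} → (ClusteredReturns q (suc p) → suc p ≤ p) →
          IsDenominator V U Λ α n q → IsDenominator V U Λ α (n + 1) q' →
          IsDenominator V U Λ α (n + p + 1) r → q + q' < r
  bound n p {q' = q'} {r} packing D D' D'' = ℕ.≰⇒> λ r≤q+q' → ℕ.1+n≰n (packing (clustered D
    (≡.subst (λ m → IsDenominator V U Λ α m q') (ℕ.+-comm n 1) D')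
    (≡.subst (λ m → IsDenominator V U Λ α m r) (ℕ.+-comm (n + p) 1) D'') r≤q+q'))
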